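{- Let $\lambda$ be a Ferrers shape and let $\mathbf a=(a_1,a_2,\dots)$ be a finite sequence of positive integers. Then $$\bigl|W^{(a_1,a_2,\dots)}_\lambda(\{231,121\})\bigr|=\bigl|W^{(a_1,a_2,\dots)}_\lambda(\{312,211\})\bigr|.$$ That is, the sets of patterns $\{231,121\}$ and $\{312,211\}$ are shape-Wilf-equivalent for words.
   Context: A Ferrers shape $\lambda=(\lambda_1,\lambda_2,\dots)$ with $\lambda_1\ge\lambda_2\ge\cdots$ is drawn in French convention: a left-justified arrangement of cells with $\lambda_i$ cells in row $i$, rows numbered from bottom (row 1) to top; columns are numbered from left to right. A $0$-$1$-filling of $\lambda$ assigns $0$ or $1$ to each cell. For a word $x=x_1x_2\cdots x_r$ over the positive integers with largest letter $M$, let $M(x)$ be the $M\times r$ $0$-$1$ matrix (rows numbered bottom to top) having a $1$ in row $x_j$ of column $j$ for each $j$, and $0$ elsewhere. A filling $F$ of $\lambda$ contains $x$ if there are rows $\rho_1<\rho_2<\dots<\rho_M$ and columns $c_1<c_2<\dots<c_r$ such that every cell (row $\rho_l$, column $c_j$) lies in $\lambda$ and the entries of $F$ in these cells form exactly the matrix $M(x)$; otherwise $F$ avoids $x$. For a set $\Omega$ of words, $W^{(a_1,a_2,\dots)}_\lambda(\Omega)$ denotes the set of $0$-$1$-fillings of $\lambda$ with exactly one $1$ in each column, exactly $a_i$ ones in row $i$ for each $i$, and which avoid every word in $\Omega$. Two sets of words $\Omega,\Sigma$ are shape-Wilf-equivalent for words if $|W^{(a_1,a_2,\dots)}_\lambda(\Omega)|=|W^{(a_1,a_2,\dots)}_\lambda(\Sigma)|$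 for all finite sequences of positive integers $a_1,a_2,\dots$ and all Ferrers shapes $\lambda$. -}

module Defs where

open import Data.Bool using (Bool; true; false)
import Data.Bool.Properties as Bool
open import Data.Fin using (Fin; toℕ; fromℕ<)
import Data.Fin as Fin
open import Data.Fin.Properties using (all?; any?; toℕ-fromℕ<)
open import Data.List using (List; []; _∷_; length; filter; foldr; lookup; allFin; cartesianProductWith)
open import Data.List.Membership.Propositional using (_∈_)
open import Data.List.Membership.Propositional.Properties using (∈-cartesianProductWith⁺)
open import Data.List.Properties using (filter-none)
open import Data.List.Relation.Unary.All using (All; []; _∷_)
import Data.List.Relation.Unary.All as All
open import Data.List.Relation.Unary.AllPairs using ([]; _∷_)
open import Data.List.Relation.Unary.Any using (here; there)
open import Data.List.Relation.Unary.Linked using (Linked)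
open import Data.List.Relation.Unary.Unique.Propositional using (Unique)
import Data.List.Relation.Unary.Unique.Propositional.Properties as Unique
open import Data.Maybe using (Maybe; just; nothing)
import Data.Maybe.Properties as Maybe
open import Data.Nat using (ℕ; zero; suc; _≤_; _<_; _≥_; _⊔_; s≤s; _≤?_; _<?_; _≟_)
open import Data.Nat.Properties using (≮⇒≥; ≤-trans; m≤m⊔n; m≤n⊔m)
open import Data.Product using (∃; ∃₂; _×_; _,_)
open import Data.Vec using (Vec; []; _∷_)
import Data.Vec as Vec
open import Data.Vec.Relation.Unary.AllPairs using (AllPairs; allPairs?)
open import Relation.Binary.PropositionalEquality using (_≡_; refl; sym; trans; cong; subst)
open import Relation.Nullary using (Dec; yes; no; does; ¬_; ¬?)
open import Relation.Nullary.Decidable using (True; map′; _×-dec_)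
open import Relation.Unary using (Decidable)

-- Rows and columns are numbered from 0, rows from bottom to top.  A finite
-- sequence is extended by zeros: a missing row of a shape has no cells, and
-- a row beyond the end of the sequence a must contain no ones.

infixl 9 _‼_
_‼_ : List ℕ → ℕ → ℕ
[]       ‼ _     = 0
(x ∷ _)  ‼ zero  = x
(_ ∷ xs) ‼ suc i = xs ‼ i

record FerrersShape : Set where
  constructor ferrers
  field
    rows       : List ℕ
    decreasing : Linked _≥_ rows

  height width : ℕ
  height = length rows
  width  = rows ‼ 0

open FerrersShape public

Filling : List ℕ → Set
Filling = All (Vec Bool)

cell : ∀ {n} → Vec Bool n → ℕ → Maybe Bool
cell []      _       = nothing
cell (b ∷ _) zero    = just b
cell (_ ∷ v) (suc c) = cell v c

-- The entry in row i and column c; it is nothing exactly when that position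
-- lies outside the shape.
entry : ∀ {ns} → Filling ns → ℕ → ℕ → Maybe Bool
entry []      _       _ = nothing
entry (v ∷ _) zero    c = cell v c
entry (_ ∷ F) (suc i) c = entry F i c

_≟ᵉ_ : (x y : Maybe Bool) → Dec (x ≡ y)
_≟ᵉ_ = Maybe.≡-dec Bool._≟_

record Word : Set where
  constructor word
  field
    letters    : List ℕ
    {positive} : True (All.all? (1 ≤?_) letters)

  largest size : ℕ
  largest = foldr _⊔_ 0 letters
  size    = length letters

open Word public

-- The matrix M(x); its row l corresponds to the letter suc l.
M : (x : Word) → Fin (largest x) → Fin (size x) → Bool
M x l j = does (lookup (letters x) j ≟ suc (toℕ l))

Contains : (Λ : FerrersShape) → Filling (rows Λ) → Word → Set
Contains Λ F x =
  ∃₂ λ (ρ : Vec (Fin (height Λ)) (largest x)) (c : Vec (Fin (width Λ)) (size x)) →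
    AllPairs Fin._<_ ρ × AllPairs Fin._<_ c ×
    (∀ l j → entry F (toℕ (Vec.lookup ρ l)) (toℕ (Vec.lookup c j)) ≡ just (M x l j))

Avoids : (Λ : FerrersShape) → Filling (rows Λ) → Word → Set
Avoids Λ F x = ¬ Contains Λ F x

onesInRow : (Λ : FerrersShape) → Filling (rows Λ) → ℕ → ℕ
onesInRow Λ F i =
  length (filter (λ c → entry F i (toℕ c) ≟ᵉ just true) (allFin (width Λ)))

onesInColumn : (Λ : FerrersShape) → Filling (rows Λ) → ℕ → ℕ
onesInColumn Λ F c =
  length (filter (λ i → entry F (toℕ i) c ≟ᵉ just true) (allFin (height Λ)))

record InW (Λ : FerrersShape) (a : List ℕ) (Ω : List Word)
           (F : Filling (rows Λ)) : Set where
  constructor inW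
  field
    columns : ∀ (c : Fin (width Λ)) → onesInColumn Λ F (toℕ c) ≡ 1
    content : ∀ i → onesInRow Λ F i ≡ a ‼ i
    avoids  : All (Avoids Λ F) Ω

anyVec? : ∀ {n} k {P : Vec (Fin n) k → Set} → Decidable P → Dec (∃ P)
anyVec? zero    P? = map′ (λ p → [] , p) (λ { ([] , p) → p }) (P? [])
anyVec? (suc k) P? =
  map′ (λ { (i , v , p) → i ∷ v , p }) (λ { (i ∷ v , p) → i , v , p })
       (any? λ i → anyVec? k λ v → P? (i ∷ v))

contains? : ∀ Λ F → Decidable (Contains Λ F)
contains? Λ F x =
  anyVec? (largest x) λ ρ → anyVec? (size x) λ c →
    allPairs? Fin._<?_ ρ ×-dec allPairs? Fin._<?_ c ×-dec
    all? λ l → all? λ j → _ ≟ᵉ _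

‼-beyond : ∀ xs {i} → length xs ≤ i → xs ‼ i ≡ 0
‼-beyond []       _         = refl
‼-beyond (_ ∷ xs) (s≤s h≤i) = ‼-beyond xs h≤i

entry-beyond : ∀ {ns} (F : Filling ns) {i} c → length ns ≤ i → entry F i c ≡ nothing
entry-beyond []      c _         = refl
entry-beyond (_ ∷ F) c (s≤s h≤i) = entry-beyond F c h≤i

onesInRow-beyond : ∀ Λ F {i} → height Λ ≤ i → onesInRow Λ F i ≡ 0
onesInRow-beyond Λ F {i} h≤i =
  cong length (filter-none (λ c → entry F i (toℕ c) ≟ᵉ just true) (All.universal none (allFin (width Λ))))
  where
  none : ∀ c → ¬ entry F i (toℕ c) ≡ just true
  none c eq with () ← trans (sym (entry-beyond F (toℕ c) h≤i)) eq

content? : ∀ Λ a F → Dec (∀ i → onesInRow Λ F i ≡ a ‼ i)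
content? Λ a F = map′ extend (λ eq i → eq (toℕ i)) (all? {bound} λ i → _ ≟ _)
  where
  bound = height Λ ⊔ length a

  extend : (∀ (i : Fin bound) → onesInRow Λ F (toℕ i) ≡ a ‼ toℕ i) →
           ∀ i → onesInRow Λ F i ≡ a ‼ i
  extend eq i with i <? bound
  ... | yes i<b = subst (λ k → onesInRow Λ F k ≡ a ‼ k) (toℕ-fromℕ< i<b) (eq (fromℕ< i<b))
  ... | no  i≮b = trans (onesInRow-beyond Λ F (≤-trans (m≤m⊔n (height Λ) (length a)) (≮⇒≥ i≮b)))
                        (sym (‼-beyond a (≤-trans (m≤n⊔m (height Λ) (length a)) (≮⇒≥ i≮b))))

inW? : ∀ Λ a Ω → Decidable (InW Λ a Ω)
inW? Λ a Ω F =
  map′ (λ { (p , q , r) → inW p q r }) (λ { (inW p q r) → p , q , r })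
       (all? (λ c → _ ≟ _) ×-dec content? Λ a F ×-dec All.all? (λ x → ¬? (contains? Λ F x)) Ω)

bitVectors : ∀ n → List (Vec Bool n)
bitVectors zero    = [] ∷ []
bitVectors (suc n) = cartesianProductWith _∷_ (false ∷ true ∷ []) (bitVectors n)

fillings : ∀ ns → List (Filling ns)
fillings []       = [] ∷ []
fillings (n ∷ ns) = cartesianProductWith _∷_ (bitVectors n) (fillings ns)

∣W∣ : FerrersShape → List ℕ → List Word → ℕ
∣W∣ Λ a Ω = length (filter (inW? Λ a Ω) (fillings (rows Λ)))

-- Every filling is listed exactly once in fillings, so ∣W∣ is a cardinality.

bitVectors-complete : ∀ {n} (v : Vec Bool n) → v ∈ bitVectors n
bitVectors-complete []      = here refl
bitVectors-complete (b ∷ v) = ∈-cartesianProductWith⁺ _∷_ (bool b) (bitVectors-complete v)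
  where
  bool : ∀ b → b ∈ false ∷ true ∷ []
  bool false = here refl
  bool true  = there (here refl)

bitVectors-unique : ∀ n → Unique (bitVectors n)
bitVectors-unique zero    = [] ∷ []
bitVectors-unique (suc n) =
  Unique.cartesianProductWith⁺ _∷_ (λ { refl → refl , refl })
    (((λ ()) ∷ []) ∷ [] ∷ []) (bitVectors-unique n)

fillings-complete : ∀ {ns} (F : Filling ns) → F ∈ fillings ns
fillings-complete []      = here refl
fillings-complete (v ∷ F) = ∈-cartesianProductWith⁺ _∷_ (bitVectors-complete v) (fillings-complete F)

fillings-unique : ∀ ns → Unique (fillings ns)
fillings-unique []       = [] ∷ []
fillings-unique (n ∷ ns) =
  Unique.cartesianProductWith⁺ _∷_ (λ { refl → refl , refl })
    (bitVectors-unique n) (fillings-unique ns)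

ShapeWilfEquivalent : List Word → List Word → Set
ShapeWilfEquivalent Ω Σ =
  ∀ (Λ : FerrersShape) (a : List ℕ) → All (1 ≤_) a → ∣W∣ Λ a Ω ≡ ∣W∣ Λ a Σ

w231 w121 w312 w211 : Word
w231 = word (2 ∷ 3 ∷ 1 ∷ [])
w121 = word (1 ∷ 2 ∷ 1 ∷ [])
w312 = word (3 ∷ 1 ∷ 2 ∷ [])
w211 = word (2 ∷ 1 ∷ 1 ∷ [])

{-# OPTIONS --safe #-}
module Submission where

-- Transposing the fillings counted for {231, 121}, both sides count 0-1 matrices on a
-- Ferrers shape without ones (i, a), (j, b), (k, c) such that j ≤ k < i, a ≤ b < c and
-- the cell (i, c) exists; one side prescribes one 1 per row and the content as
-- column sums, the other the content as row sums and one 1 per column.  Add the rows from bottom to top and retire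
-- the columns from right to left where the shape narrows.  The columns that can take a
-- new 1 depend only on a division of the live ones into consecutive blocks: a new 1
-- goes into the last block and starts a new block there.  Summing over all ways of
-- distributing the ones over columns, a side becomes a number of walks on compositions,
-- with one operator E or E↑ per 1 of a row and S or S↑ per 1 of a retired column.  If g
-- splits the last block in all possible ways, then
--   S gᵏ E = 1 + g + ⋯ + gᵏ⁺¹,   S↑ gᵏ E = gᵏ⁺¹ = S gᵏ E↑.
-- By induction on the number of steps S and S↑ these relations determine the number of
-- closed walks.  They are invariant under reversing a walk and exchanging insertions with
-- deletions, which exchanges the two sides.

open import Defs
open import Data.Bool using (Bool; true; false; T; _∧_; _∨_; if_then_else_)
import Data.Bool.Properties as Bool
open import Data.Bool.Properties using (∨-identityʳ; ∨-zeroʳ; ∧-identityʳ; ∧-zeroʳ)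
open import Data.Empty using (⊥; ⊥-elim)
open import Data.Fin using (Fin; zero; suc; toℕ; fromℕ<)
import Data.Fin as Fin
open import Data.Fin.Patterns
import Data.Fin.Properties as Fin
open import Data.List using (List; []; _∷_; _++_; length; map; drop; filter; lookup; replicate; tabulate; allFin; cartesianProductWith)
open import Data.List.Membership.Propositional using (_∈_)
open import Data.List.Membership.Propositional.Properties using (∈-filter⁺; ∈-filter⁻; ∈-lookup)
open import Data.List.Membership.Setoid.Properties using (index-injective)
open import Data.List.Properties using (++-assoc; ++-identityʳ; filter-none; length-++; length-drop; length-map; length-replicate)
open import Data.List.Relation.Unary.All using (All; []; _∷_)
import Data.List.Relation.Unary.All as All
open import Data.List.Relation.Unary.AllPairs using ([]; _∷_)
open import Data.List.Relation.Unary.Any using (index)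
open import Data.List.Relation.Unary.Linked using (Linked; []; [-]; _∷_)
open import Data.List.Relation.Unary.Unique.Propositional using (Unique)
import Data.List.Relation.Unary.Unique.Propositional.Properties as Unique
open import Data.Maybe using (Maybe; just; nothing)
open import Data.Nat using (ℕ; zero; suc; _+_; _∸_; _≤_; _<_; _≥_; _≡ᵇ_; _≤?_; _<?_; z≤n; s≤s)
open import Data.Nat.Properties
open import Algebra.Properties.CommutativeSemigroup +-commutativeSemigroup using (interchange)
open import Data.Product using (∃; ∃₂; _×_; _,_; proj₁; proj₂)
open import Data.Sum using (_⊎_; inj₁; inj₂)
open import Data.Unit using (⊤; tt)
open import Data.Vec using (Vec; []; _∷_)
import Data.Vec as Vec
open import Data.Vec.Relation.Unary.All using ([]; _∷_)
import Data.Vec.Relation.Unary.All.Properties as VecAll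
open import Data.Vec.Relation.Unary.AllPairs using (AllPairs; []; _∷_)
open import Function using (_∘_; const; flip; id)
open import Relation.Binary.Definitions using (tri<; tri≈; tri>)
open import Relation.Binary.PropositionalEquality
open import Relation.Nullary using (Dec; yes; no; does; ¬_; contradiction)
open import Relation.Nullary.Decidable using (True; toWitness)
open import Relation.Unary using (Decidable)

-- Walks on compositions

-- A block is a run of nonempty columns, from left to right, each with all its ones strictly lower
-- than those of the one before. A new topmost 1 in column `a` completes a forbidden triple exactly
-- when columns `b < c`, both at or right of `a`, hold a 1 of `b` weakly lower than a 1 of `c`. So
-- it must stay right of the last nonempty column before the last block. Whatever the block has in
-- that column or right of it joins the block that starts there. The arrows record two constraints
-- of order. The ones of a row are placed from left to right, so a later one may not go below the
-- first unit of the block that the previous one started: this is E↑. The ones of a retired column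
-- lie in one block, so only the last of them to go may exhaust a block: this is S↑. Splitting
-- enters because an insertion is a splitting of the last block lengthened by one unit. The obstacle
-- is that insertion has many outcomes and deletion at most one, so reversal does not match walks
-- one by one. Only the relations are symmetric: the first is its own reverse, and the other two are
-- reverses of each other.

sum< : ℕ → (ℕ → ℕ) → ℕ
sum< zero    f = 0
sum< (suc n) f = f 0 + sum< n (f ∘ suc)

sum<-cong : ∀ n {f h : ℕ → ℕ} → f ≗ h → sum< n f ≡ sum< n h
sum<-cong zero    f≗h = refl
sum<-cong (suc n) f≗h = cong₂ _+_ (f≗h 0) (sum<-cong n (f≗h ∘ suc))

sum<-zero : ∀ n {f : ℕ → ℕ} → (∀ i → f i ≡ 0) → sum< n f ≡ 0
sum<-zero zero    f≡0 = refl
sum<-zero (suc n) f≡0 = cong₂ _+_ (f≡0 0) (sum<-zero n (f≡0 ∘ suc))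

-- Additivity is enough, since cancellation in ℕ yields preservation of zero. The field `ext` takes
-- the place of function extensionality when an identity is rewritten below an operator.
record Linear {A B : Set} (O : (A → ℕ) → B → ℕ) : Set where
  field
    ext : ∀ {f h} → f ≗ h → O f ≗ O h
    add : ∀ f h → O (λ x → f x + h x) ≗ λ y → O f y + O h y

  vanish : O (λ _ → 0) ≗ λ _ → 0
  vanish y = sym (+-cancelˡ-≡ (O (λ _ → 0) y) _ _
    (trans (+-identityʳ _) (add (λ _ → 0) (λ _ → 0) y)))

  sums : ∀ n (F : ℕ → A → ℕ) → O (λ x → sum< n (λ i → F i x)) ≗ λ y → sum< n (λ i → O (F i) y)
  sums zero    F y = vanish y
  sums (suc n) F y = trans (add (F 0) _ y) (cong (O (F 0) y +_) (sums n (F ∘ suc) y))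

open Linear public

infixr 9 _∘ᴸ_
_∘ᴸ_ : ∀ {A B C} {O : (B → ℕ) → C → ℕ} {Q : (A → ℕ) → B → ℕ} →
       Linear O → Linear Q → Linear (O ∘ Q)
ext (o ∘ᴸ q) f≗h = ext o (ext q f≗h)
add (o ∘ᴸ q) f h y = trans (ext o (add q f h) y) (add o _ _ y)

idᴸ : ∀ {A} → Linear {A} id
ext idᴸ f≗h = f≗h
add idᴸ f h y = refl

infixr 8 _^_
_^_ : ∀ {A : Set} → (A → A) → ℕ → A → A
(O ^ zero)  x = x
(O ^ suc k) x = O ((O ^ k) x)

powᴸ : ∀ {A} {O : (A → ℕ) → A → ℕ} → Linear O → ∀ k → Linear (O ^ k)
powᴸ o zero    = idᴸ
powᴸ o (suc k) = o ∘ᴸ powᴸ o k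

-- A composition as a list of units, last one first.  A unit is marked true when it starts
-- a block; the first unit always does, so ne l has one more unit than l has marks.
data State : Set where
  ε  : State
  ne : List Bool → State

Functional : Set
Functional = State → ℕ

Operator : Set
Operator = Functional → Functional

-- Operators act on functions of states, so a composite is read in the order of time.  A unit
-- is inserted anywhere in the last block and starts a block; insert↑ omits the lowest place,
-- where the new block would absorb the old one, and pop↑ refuses to empty a block.
splitᴮ insertᴮ insert↑ᴮ : (List Bool → ℕ) → List Bool → ℕ
splitᴮ F []          = F []
splitᴮ F (true ∷ l)  = F (true ∷ l)
splitᴮ F (false ∷ l) = F (true ∷ l) + splitᴮ (F ∘ (false ∷_)) l

insertᴮ F l = splitᴮ F (false ∷ l)

insert↑ᴮ F []          = F (true ∷ [])
insert↑ᴮ F (true ∷ l)  = F (true ∷ true ∷ l)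
insert↑ᴮ F (false ∷ l) = F (true ∷ false ∷ l) + insert↑ᴮ (F ∘ (false ∷_)) l

split insert insert↑ pop pop↑ : Operator
-- With the value zero here, only the summand without splittings survives at `ε` in `insert-pop`: an
-- insertion into nothing can be undone in exactly one way.
split F ε      = 0
split F (ne l) = splitᴮ (F ∘ ne) l

insert F ε      = F (ne [])
insert F (ne l) = insertᴮ (F ∘ ne) l

insert↑ F ε      = 0
insert↑ F (ne l) = insert↑ᴮ (F ∘ ne) l

pop F ε            = 0
pop F (ne [])      = F ε
pop F (ne (_ ∷ l)) = F (ne l)

pop↑ F ε                = 0
pop↑ F (ne [])          = 0
pop↑ F (ne (true ∷ l))  = 0
pop↑ F (ne (false ∷ l)) = F (ne l)

splitᴮ-linear : Linear splitᴮ
splitᴮ-linear = record { ext = e ; add = a }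
  where
  e : ∀ {f h} → f ≗ h → splitᴮ f ≗ splitᴮ h
  e f≗h []          = f≗h []
  e f≗h (true ∷ l)  = f≗h (true ∷ l)
  e f≗h (false ∷ l) = cong₂ _+_ (f≗h (true ∷ l)) (e (f≗h ∘ (false ∷_)) l)
  a : ∀ f h → splitᴮ (λ x → f x + h x) ≗ λ l → splitᴮ f l + splitᴮ h l
  a f h []          = refl
  a f h (true ∷ l)  = refl
  a f h (false ∷ l) = trans (cong (f (true ∷ l) + h (true ∷ l) +_) (a (f ∘ (false ∷_)) (h ∘ (false ∷_)) l))
                            (interchange (f (true ∷ l)) (h (true ∷ l))
                               (splitᴮ (f ∘ (false ∷_)) l) (splitᴮ (h ∘ (false ∷_)) l))

insert↑ᴮ-linear : Linear insert↑ᴮ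
insert↑ᴮ-linear = record { ext = e ; add = a }
  where
  e : ∀ {f h} → f ≗ h → insert↑ᴮ f ≗ insert↑ᴮ h
  e f≗h []          = f≗h (true ∷ [])
  e f≗h (true ∷ l)  = f≗h (true ∷ true ∷ l)
  e f≗h (false ∷ l) = cong₂ _+_ (f≗h (true ∷ false ∷ l)) (e (f≗h ∘ (false ∷_)) l)
  a : ∀ f h → insert↑ᴮ (λ x → f x + h x) ≗ λ l → insert↑ᴮ f l + insert↑ᴮ h l
  a f h []          = refl
  a f h (true ∷ l)  = refl
  a f h (false ∷ l) = trans (cong (f (true ∷ false ∷ l) + h (true ∷ false ∷ l) +_)
                              (a (f ∘ (false ∷_)) (h ∘ (false ∷_)) l))
                            (interchange (f (true ∷ false ∷ l)) (h (true ∷ false ∷ l))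
                               (insert↑ᴮ (f ∘ (false ∷_)) l) (insert↑ᴮ (h ∘ (false ∷_)) l))

split-linear : Linear split
ext split-linear f≗h ε      = refl
ext split-linear f≗h (ne l) = ext splitᴮ-linear (f≗h ∘ ne) l
add split-linear f h ε      = refl
add split-linear f h (ne l) = add splitᴮ-linear (f ∘ ne) (h ∘ ne) l

insert-linear : Linear insert
ext insert-linear f≗h ε      = f≗h (ne [])
ext insert-linear f≗h (ne l) = ext splitᴮ-linear (f≗h ∘ ne) (false ∷ l)
add insert-linear f h ε      = refl
add insert-linear f h (ne l) = add splitᴮ-linear (f ∘ ne) (h ∘ ne) (false ∷ l)

insert↑-linear : Linear insert↑
ext insert↑-linear f≗h ε      = refl
ext insert↑-linear f≗h (ne l) = ext insert↑ᴮ-linear (f≗h ∘ ne) l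
add insert↑-linear f h ε      = refl
add insert↑-linear f h (ne l) = add insert↑ᴮ-linear (f ∘ ne) (h ∘ ne) l

pop-linear : Linear pop
ext pop-linear f≗h ε            = refl
ext pop-linear f≗h (ne [])      = f≗h ε
ext pop-linear f≗h (ne (_ ∷ l)) = f≗h (ne l)
add pop-linear f h ε            = refl
add pop-linear f h (ne [])      = refl
add pop-linear f h (ne (_ ∷ l)) = refl

pop↑-linear : Linear pop↑
ext pop↑-linear f≗h ε                = refl
ext pop↑-linear f≗h (ne [])          = refl
ext pop↑-linear f≗h (ne (true ∷ l))  = refl
ext pop↑-linear f≗h (ne (false ∷ l)) = f≗h (ne l)
add pop↑-linear f h ε                = refl
add pop↑-linear f h (ne [])          = refl
add pop↑-linear f h (ne (true ∷ l))  = refl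
add pop↑-linear f h (ne (false ∷ l)) = refl

-- Relations between insertion, splitting and deletion

split^-true : ∀ k F l → (split ^ k) F (ne (true ∷ l)) ≡ F (ne (true ∷ l))
split^-true zero    F l = refl
split^-true (suc k) F l = split^-true k F l

split^-[] : ∀ k F → (split ^ k) F (ne []) ≡ F (ne [])
split^-[] zero    F = refl
split^-[] (suc k) F = split^-[] k F

-- Once a splitting isolates the last unit, later ones do nothing and the deletion removes that
-- unit. The summand `n` collects the histories with `n` splittings before this happens; `n = k`
-- means that it never does.
split^-pop-false : ∀ k F l →
  (split ^ k) (pop F) (ne (false ∷ l)) ≡ sum< (suc k) (λ n → (split ^ n) F (ne l))
split^-pop-false zero    F l = sym (+-identityʳ _)
split^-pop-false (suc k) F l = cong₂ _+_
  (split^-true k (pop F) l)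
  (trans (ext splitᴮ-linear (split^-pop-false k F) l)
         (sums splitᴮ-linear (suc k) (λ n l → (split ^ n) F (ne l)) l))

-- Isolating the last unit is fatal here, because `pop↑` may not empty a block. Only the histories
-- that never isolate it remain.
split^-pop↑-false : ∀ k F l →
  (split ^ k) (pop↑ F) (ne (false ∷ l)) ≡ (split ^ k) F (ne l)
split^-pop↑-false zero    F l = refl
split^-pop↑-false (suc k) F l = cong₂ _+_
  (split^-true k (pop↑ F) l)
  (ext splitᴮ-linear (split^-pop↑-false k F) l)

-- An insertion appends an unmarked unit and splits once, so it counts as one more splitting in
-- `split^-pop-false`.
insert-pop : ∀ k F →
  insert ((split ^ k) (pop F)) ≗ λ x → sum< (2 + k) (λ n → (split ^ n) F x)
insert-pop k F ε      = trans (split^-[] k (pop F))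
  (sym (trans (cong (F ε +_) (sum<-zero (suc k) (λ _ → refl))) (+-identityʳ (F ε))))
insert-pop k F (ne l) = split^-pop-false (suc k) F l

insert-pop↑ : ∀ k F → insert ((split ^ k) (pop↑ F)) ≗ (split ^ suc k) F
insert-pop↑ k F ε      = split^-[] k (pop↑ F)
insert-pop↑ k F (ne l) = split^-pop↑-false (suc k) F l

insertᴮ-top : ∀ F l → insertᴮ F l ≡ insert↑ᴮ F l + F (false ∷ l)
insertᴮ-top F []          = refl
insertᴮ-top F (true ∷ l)  = refl
insertᴮ-top F (false ∷ l) =
  trans (cong (F (true ∷ false ∷ l) +_) (insertᴮ-top (F ∘ (false ∷_)) l))
        (sym (+-assoc (F (true ∷ false ∷ l)) _ _))

sum<-last : ∀ n f → sum< (suc n) f ≡ f n + sum< n f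
sum<-last zero    f = refl
sum<-last (suc n) f = trans (cong (f 0 +_) (sum<-last n (f ∘ suc)))
  (trans (sym (+-assoc (f 0) _ _)) (trans (cong (_+ sum< n (f ∘ suc)) (+-comm (f 0) _)) (+-assoc (f (suc n)) _ _)))

-- The lowest place accounts for the sum with exponents up to `k`, all places together for the sum
-- up to `suc k`. Cancelling the former leaves the top power.
insert↑-pop : ∀ k F → insert↑ ((split ^ k) (pop F)) ≗ (split ^ suc k) F
insert↑-pop k F ε      = refl
insert↑-pop k F (ne l) = +-cancelʳ-≡ (sum< (suc k) (λ n → (split ^ n) F (ne l))) _ _ (begin
  insert↑ᴮ h l + sum< (suc k) (λ n → (split ^ n) F (ne l)) ≡⟨ cong (insert↑ᴮ h l +_) (split^-pop-false k F l) ⟨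
  insert↑ᴮ h l + h (false ∷ l)                             ≡⟨ insertᴮ-top h l ⟨
  insertᴮ h l                                              ≡⟨ split^-pop-false (suc k) F l ⟩
  sum< (2 + k) (λ n → (split ^ n) F (ne l))                ≡⟨ sum<-last (suc k) (λ n → (split ^ n) F (ne l)) ⟩
  (split ^ suc k) F (ne l) + sum< (suc k) (λ n → (split ^ n) F (ne l)) ∎)
  where
  open ≡-Reasoning
  h : List Bool → ℕ
  h = (split ^ k) (pop F) ∘ ne

-- The boundary of a shape from its top left to its bottom right corner: east is a column,
-- south and the south↑ before it are the ones of a row.
data Step : Set where
  east south south↑ : Step

forward backward : Step → Operator
forward east   = insert
forward south  = pop
forward south↑ = pop↑

backward east   = pop
backward south  = insert
backward south↑ = insert↑

-- In `run⃖` the first step is applied innermost, so the path is walked from its end, with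
-- insertions and deletions exchanged.
run⃗ run⃖ : List Step → Operator
run⃗ []       F = F
run⃗ (s ∷ ss) F = forward s (run⃗ ss F)
run⃖ []       F = F
run⃖ (s ∷ ss) F = run⃖ ss (backward s F)

δ : Functional
δ ε      = 1
δ (ne _) = 0

-- The steps already read before the first south step, the latest first, when the relations
-- have turned the earlier south steps into gaps, that is, into splittings.
data Pending : Set where
  east gap : Pending

prefix⃗ : List Pending → Operator
prefix⃗ []         F = F
prefix⃗ (east ∷ p) F = prefix⃗ p (insert F)
prefix⃗ (gap ∷ p)  F = prefix⃗ p (split F)

prefix⃖ : List Pending → Functional
prefix⃖ []         = δ
prefix⃖ (east ∷ p) = pop (prefix⃖ p)
prefix⃖ (gap ∷ p)  = split (prefix⃖ p)

backward-linear : ∀ s → Linear (backward s)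
backward-linear east   = pop-linear
backward-linear south  = insert-linear
backward-linear south↑ = insert↑-linear

run⃖-linear : ∀ ss → Linear (run⃖ ss)
run⃖-linear []       = idᴸ
run⃖-linear (s ∷ ss) = run⃖-linear ss ∘ᴸ backward-linear s

prefix⃗-linear : ∀ p → Linear (prefix⃗ p)
prefix⃗-linear []         = idᴸ
prefix⃗-linear (east ∷ p) = prefix⃗-linear p ∘ᴸ insert-linear
prefix⃗-linear (gap ∷ p)  = prefix⃗-linear p ∘ᴸ split-linear

gaps : ℕ → List Pending → List Pending
gaps k p = replicate k gap ++ p

^-shift : ∀ {A : Set} (O : A → A) k x → (O ^ k) (O x) ≡ O ((O ^ k) x)
^-shift O zero    x = refl
^-shift O (suc k) x = cong O (^-shift O k x)

prefix⃗-gaps : ∀ k p F → prefix⃗ (gaps k p) F ≡ prefix⃗ p ((split ^ k) F)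
prefix⃗-gaps zero    p F = refl
prefix⃗-gaps (suc k) p F = trans (prefix⃗-gaps k p (split F)) (cong (prefix⃗ p) (^-shift split k F))

prefix⃖-gaps : ∀ k p → prefix⃖ (gaps k p) ≡ (split ^ k) (prefix⃖ p)
prefix⃖-gaps zero    p = refl
prefix⃖-gaps (suc k) p = cong split (prefix⃖-gaps k p)

-- No insertion or splitting ends at the empty composition, and no deletion or splitting starts
-- there. Hence a nonempty prefix contributes zero to both sides.
prefix-end : ∀ p → prefix⃗ p δ ε ≡ prefix⃖ p ε
prefix-end []         = refl
prefix-end (east ∷ p) = trans (ext (prefix⃗-linear p) none ε) (vanish (prefix⃗-linear p) ε)
  where
  none : insert δ ≗ λ _ → 0
  none ε      = refl
  none (ne l) = vanish splitᴮ-linear (false ∷ l)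
prefix-end (gap ∷ p) = trans (ext (prefix⃗-linear p) none ε) (vanish (prefix⃗-linear p) ε)
  where
  none : split δ ≗ λ _ → 0
  none ε      = refl
  none (ne l) = vanish splitᴮ-linear l

-- The most recent insertion and the number of gaps after it are exactly what the left side of a
-- relation needs when a south step arrives.
data LastEast : List Pending → Set where
  noEast    : ∀ k → LastEast (gaps k [])
  eastAfter : ∀ k p → LastEast (gaps k (east ∷ p))

lastEast : ∀ p → LastEast p
lastEast []         = noEast 0
lastEast (east ∷ p) = eastAfter 0 p
lastEast (gap ∷ p) with lastEast p
... | noEast k   = noEast (suc k)
... | eastAfter k q = eastAfter (suc k) q

split^-ε : ∀ k F → F ε ≡ 0 → (split ^ k) F ε ≡ 0
split^-ε zero    F F≡0 = F≡0
split^-ε (suc k) F F≡0 = refl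

split^-δ : ∀ k l → (split ^ k) δ (ne l) ≡ 0
split^-δ zero    l = refl
split^-δ (suc k) l = trans (ext splitᴮ-linear (split^-δ k) l) (vanish splitᴮ-linear l)

-- Each south step is cancelled against the latest insertion, leaving only gaps, so the remaining
-- path gets shorter while the prefix is arbitrary. Both directions turn into the same sum over new
-- prefixes, to which the induction applies.
run-prefix : ∀ p ss → prefix⃗ p (run⃗ ss δ) ε ≡ run⃖ ss (prefix⃖ p) ε
run-prefix p []          = prefix-end p
run-prefix p (east ∷ ss) = run-prefix (east ∷ p) ss
run-prefix p (south ∷ ss) with lastEast p
... | noEast k = begin
  prefix⃗ (gaps k []) (pop F) ε          ≡⟨ cong-app (prefix⃗-gaps k [] (pop F)) ε ⟩
  (split ^ k) (pop F) ε                 ≡⟨ split^-ε k (pop F) refl ⟩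
  0                                     ≡⟨ vanish (run⃖-linear ss) ε ⟨
  run⃖ ss (λ _ → 0) ε                   ≡⟨ ext (run⃖-linear ss) dead ε ⟨
  run⃖ ss (insert (prefix⃖ (gaps k []))) ε ∎
  where
  open ≡-Reasoning
  F : Functional
  F = run⃗ ss δ
  -- The inserted unit is never removed, so `δ` rejects every outcome; forward, there is no unit to
  -- delete.
  dead : insert (prefix⃖ (gaps k [])) ≗ λ _ → 0
  dead x rewrite prefix⃖-gaps k [] = d x
    where
    d : insert ((split ^ k) δ) ≗ λ _ → 0
    d ε      = split^-δ k []
    d (ne l) = split^-δ (suc k) (false ∷ l)
... | eastAfter k q = begin
  prefix⃗ (gaps k (east ∷ q)) (pop F) ε
    ≡⟨ cong-app (prefix⃗-gaps k (east ∷ q) (pop F)) ε ⟩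
  prefix⃗ q (insert ((split ^ k) (pop F))) ε
    ≡⟨ ext (prefix⃗-linear q) (insert-pop k F) ε ⟩
  prefix⃗ q (λ x → sum< (2 + k) (λ n → (split ^ n) F x)) ε
    ≡⟨ sums (prefix⃗-linear q) (2 + k) (λ n → (split ^ n) F) ε ⟩
  sum< (2 + k) (λ n → prefix⃗ q ((split ^ n) F) ε)
    ≡⟨ sum<-cong (2 + k) step ⟩
  sum< (2 + k) (λ n → run⃖ ss ((split ^ n) (prefix⃖ q)) ε)
    ≡⟨ sums (run⃖-linear ss) (2 + k) (λ n → (split ^ n) (prefix⃖ q)) ε ⟨
  run⃖ ss (λ x → sum< (2 + k) (λ n → (split ^ n) (prefix⃖ q) x)) ε
    ≡⟨ ext (run⃖-linear ss) (insert-pop k (prefix⃖ q)) ε ⟨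
  run⃖ ss (insert ((split ^ k) (pop (prefix⃖ q)))) ε
    ≡⟨ cong (λ h → run⃖ ss (insert h) ε) (prefix⃖-gaps k (east ∷ q)) ⟨
  run⃖ ss (insert (prefix⃖ (gaps k (east ∷ q)))) ε ∎
  where
  open ≡-Reasoning
  F : Functional
  F = run⃗ ss δ
  step : ∀ n → prefix⃗ q ((split ^ n) F) ε ≡ run⃖ ss ((split ^ n) (prefix⃖ q)) ε
  step n = trans (sym (cong-app (prefix⃗-gaps n q F) ε))
    (trans (run-prefix (gaps n q) ss) (cong (λ h → run⃖ ss h ε) (prefix⃖-gaps n q)))
run-prefix p (south↑ ∷ ss) with lastEast p
... | noEast k = begin
  prefix⃗ (gaps k []) (pop↑ F) ε          ≡⟨ cong-app (prefix⃗-gaps k [] (pop↑ F)) ε ⟩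
  (split ^ k) (pop↑ F) ε                 ≡⟨ split^-ε k (pop↑ F) refl ⟩
  0                                      ≡⟨ vanish (run⃖-linear ss) ε ⟨
  run⃖ ss (λ _ → 0) ε                    ≡⟨ ext (run⃖-linear ss) dead ε ⟨
  run⃖ ss (insert↑ (prefix⃖ (gaps k []))) ε ∎
  where
  open ≡-Reasoning
  F : Functional
  F = run⃗ ss δ
  dead : insert↑ (prefix⃖ (gaps k [])) ≗ λ _ → 0
  dead x rewrite prefix⃖-gaps k [] = d x
    where
    d : insert↑ ((split ^ k) δ) ≗ λ _ → 0
    d ε      = refl
    d (ne l) = trans (ext insert↑ᴮ-linear (split^-δ k) l) (vanish insert↑ᴮ-linear l)
... | eastAfter k q = begin
  prefix⃗ (gaps k (east ∷ q)) (pop↑ F) ε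
    ≡⟨ cong-app (prefix⃗-gaps k (east ∷ q) (pop↑ F)) ε ⟩
  prefix⃗ q (insert ((split ^ k) (pop↑ F))) ε
    -- Forward the arrow sits on the deletion, backward on the insertion; both reduce to the same
    -- power of `split`.
    ≡⟨ ext (prefix⃗-linear q) (insert-pop↑ k F) ε ⟩
  prefix⃗ q ((split ^ suc k) F) ε
    ≡⟨ cong-app (prefix⃗-gaps (suc k) q F) ε ⟨
  prefix⃗ (gaps (suc k) q) F ε
    ≡⟨ run-prefix (gaps (suc k) q) ss ⟩
  run⃖ ss (prefix⃖ (gaps (suc k) q)) ε
    ≡⟨ cong (λ h → run⃖ ss h ε) (prefix⃖-gaps (suc k) q) ⟩
  run⃖ ss ((split ^ suc k) (prefix⃖ q)) ε
    ≡⟨ ext (run⃖-linear ss) (insert↑-pop k (prefix⃖ q)) ε ⟨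
  run⃖ ss (insert↑ ((split ^ k) (pop (prefix⃖ q)))) ε
    ≡⟨ cong (λ h → run⃖ ss (insert↑ h) ε) (prefix⃖-gaps k (east ∷ q)) ⟨
  run⃖ ss (insert↑ (prefix⃖ (gaps k (east ∷ q)))) ε ∎
  where
  open ≡-Reasoning
  F : Functional
  F = run⃗ ss δ

run⃗≡run⃖ : ∀ ss → run⃗ ss δ ε ≡ run⃖ ss δ ε
run⃗≡run⃖ = run-prefix []

-- Distributing the ones over columns

gate : Bool → ℕ → ℕ
gate true  x = x
gate false x = 0

gate-zero : ∀ b → gate b 0 ≡ 0
gate-zero true  = refl
gate-zero false = refl

-- Columns are listed from right to left.  In ones u b there are u + 1 ones, and b tells
-- whether a block starts at the lowest of them.
data Column : Set where
  blank : Column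
  ones  : ℕ → Bool → Column

tally : Column → ℕ
tally blank      = 0
tally (ones u _) = suc u

Weight : Set
Weight = List Column → ℕ

-- The sum of f over all ways of cutting the units of a state into n columns; all units
-- of a column lie in one block.
parse : ℕ → Weight → State → ℕ
group : ℕ → (ℕ → Bool → Weight) → List Bool → ℕ

parse zero    f ε      = f []
parse zero    f (ne l) = 0
parse (suc n) f ε      = parse n (f ∘ (blank ∷_)) ε
parse (suc n) f (ne l) = parse n (f ∘ (blank ∷_)) (ne l) + group n (λ u b s → f (ones u b ∷ s)) l

group n φ []          = parse n (φ 0 true) ε
group n φ (true ∷ l)  = parse n (φ 0 true) (ne l)
group n φ (false ∷ l) = parse n (φ 0 false) (ne l) + group n (φ ∘ suc) l

parse-ext : ∀ n {f h} → f ≗ h → parse n f ≗ parse n h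
group-ext : ∀ n {φ ψ} → (∀ u b → φ u b ≗ ψ u b) → group n φ ≗ group n ψ

parse-ext zero    f≗h ε      = f≗h []
parse-ext zero    f≗h (ne l) = refl
parse-ext (suc n) f≗h ε      = parse-ext n (f≗h ∘ (blank ∷_)) ε
parse-ext (suc n) f≗h (ne l) =
  cong₂ _+_ (parse-ext n (f≗h ∘ (blank ∷_)) (ne l)) (group-ext n (λ u b s → f≗h (ones u b ∷ s)) l)

group-ext n φ≗ψ []          = parse-ext n (φ≗ψ 0 true) ε
group-ext n φ≗ψ (true ∷ l)  = parse-ext n (φ≗ψ 0 true) (ne l)
group-ext n φ≗ψ (false ∷ l) = cong₂ _+_ (parse-ext n (φ≗ψ 0 false) (ne l)) (group-ext n (φ≗ψ ∘ suc) l)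

parse-add : ∀ n f h → parse n (λ s → f s + h s) ≗ λ x → parse n f x + parse n h x
group-add : ∀ n φ ψ → group n (λ u b s → φ u b s + ψ u b s) ≗ λ l → group n φ l + group n ψ l

parse-add zero    f h ε      = refl
parse-add zero    f h (ne l) = refl
parse-add (suc n) f h ε      = parse-add n (f ∘ (blank ∷_)) (h ∘ (blank ∷_)) ε
parse-add (suc n) f h (ne l) = trans
  (cong₂ _+_ (parse-add n (f ∘ (blank ∷_)) (h ∘ (blank ∷_)) (ne l))
             (group-add n (λ u b s → f (ones u b ∷ s)) (λ u b s → h (ones u b ∷ s)) l))
  (interchange (parse n (f ∘ (blank ∷_)) (ne l)) (parse n (h ∘ (blank ∷_)) (ne l))
     (group n (λ u b s → f (ones u b ∷ s)) l) (group n (λ u b s → h (ones u b ∷ s)) l))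

group-add n φ ψ []          = parse-add n (φ 0 true) (ψ 0 true) ε
group-add n φ ψ (true ∷ l)  = parse-add n (φ 0 true) (ψ 0 true) (ne l)
group-add n φ ψ (false ∷ l) = trans
  (cong₂ _+_ (parse-add n (φ 0 false) (ψ 0 false) (ne l)) (group-add n (φ ∘ suc) (ψ ∘ suc) l))
  (interchange (parse n (φ 0 false) (ne l)) (parse n (ψ 0 false) (ne l))
     (group n (φ ∘ suc) l) (group n (ψ ∘ suc) l))

parse-linear : ∀ n → Linear (parse n)
ext (parse-linear n) = parse-ext n
add (parse-linear n) = parse-add n

group-zero : ∀ n {φ} → (∀ u b s → φ u b s ≡ 0) → ∀ l → group n φ l ≡ 0
group-zero n φ≡0 []          = trans (parse-ext n (φ≡0 0 true) ε) (vanish (parse-linear n) ε)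
group-zero n φ≡0 (true ∷ l)  = trans (parse-ext n (φ≡0 0 true) (ne l)) (vanish (parse-linear n) (ne l))
group-zero n φ≡0 (false ∷ l) =
  cong₂ _+_ (trans (parse-ext n (φ≡0 0 false) (ne l)) (vanish (parse-linear n) (ne l)))
            (group-zero n (φ≡0 ∘ suc) l)

-- Insertion when the columns are known, scanning from the right. Once the scan passes the column
-- where the last block starts, that column loses its mark and `belowᶜ` takes over: only blank
-- columns before the next nonempty one remain. The guard `occupiedᶜ` demands an older unit further
-- left, so that the new one is not at the lowest place.
belowᶜ insertᶜ occupiedᶜ insert↑ᶜ : Weight → Weight
insertOnᶜ insertOn↑ᶜ : (ℕ → Bool → Weight) → ℕ → Bool → Weight

belowᶜ f []             = 0
belowᶜ f (blank ∷ s)    = belowᶜ (f ∘ (blank ∷_)) s + f (ones 0 true ∷ s)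
belowᶜ f (ones _ _ ∷ s) = 0

insertᶜ f []             = 0
insertᶜ f (blank ∷ s)    = insertᶜ (f ∘ (blank ∷_)) s + f (ones 0 true ∷ s)
insertᶜ f (ones u b ∷ s) = insertOnᶜ (λ u b s → f (ones u b ∷ s)) u b s

insertOnᶜ φ u false s = insertᶜ (φ u false) s + φ (suc u) true s
insertOnᶜ φ u true  s = belowᶜ (φ u false) s + φ (suc u) true s

occupiedᶜ f []             = 0
occupiedᶜ f (blank ∷ s)    = occupiedᶜ (f ∘ (blank ∷_)) s
occupiedᶜ f (ones u b ∷ s) = f (ones u b ∷ s)

insert↑ᶜ f []             = 0
insert↑ᶜ f (blank ∷ s)    = insert↑ᶜ (f ∘ (blank ∷_)) s + occupiedᶜ (f ∘ (ones 0 true ∷_)) s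
insert↑ᶜ f (ones u b ∷ s) = insertOn↑ᶜ (λ u b s → f (ones u b ∷ s)) u b s

insertOn↑ᶜ φ u false s = insert↑ᶜ (φ u false) s + occupiedᶜ (φ (suc u) true) s
insertOn↑ᶜ φ u true  s = 0

parse-belowᶜ-ε : ∀ n f → parse n f (ne []) ≡ parse n (belowᶜ f) ε
parse-belowᶜ-ε zero    f = refl
parse-belowᶜ-ε (suc n) f = trans
  (cong (_+ parse n (f ∘ (ones 0 true ∷_)) ε) (parse-belowᶜ-ε n (f ∘ (blank ∷_))))
  (sym (parse-add n _ (f ∘ (ones 0 true ∷_)) ε))

-- A last unit that forms its own block is alone in the rightmost nonempty column. Erasing it leaves
-- a cutting of the other units in which this column is blank.
parse-belowᶜ-ne : ∀ n f l → parse n f (ne (true ∷ l)) ≡ parse n (belowᶜ f) (ne l)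
parse-belowᶜ-ne zero    f l = refl
parse-belowᶜ-ne (suc n) f l = begin
  parse n (f ∘ (blank ∷_)) (ne (true ∷ l)) + parse n (f ∘ (ones 0 true ∷_)) (ne l)
    ≡⟨ cong (_+ parse n (f ∘ (ones 0 true ∷_)) (ne l)) (parse-belowᶜ-ne n (f ∘ (blank ∷_)) l) ⟩
  parse n (belowᶜ (f ∘ (blank ∷_))) (ne l) + parse n (f ∘ (ones 0 true ∷_)) (ne l)
    ≡⟨ parse-add n _ (f ∘ (ones 0 true ∷_)) (ne l) ⟨
  parse n (belowᶜ f ∘ (blank ∷_)) (ne l)
    ≡⟨ +-identityʳ _ ⟨
  parse n (belowᶜ f ∘ (blank ∷_)) (ne l) + 0
    ≡⟨ cong (parse n (belowᶜ f ∘ (blank ∷_)) (ne l) +_) (group-zero n (λ _ _ _ → refl) l) ⟨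
  parse (suc n) (belowᶜ f) (ne l) ∎
  where open ≡-Reasoning

-- Summing over the cuttings forgets the columns and turns column insertion into insertion of a
-- unit. In the companion `group-insertᶜ` the separate summand is the new unit alone in the
-- rightmost nonempty column; here it pairs with the filling of a blank head.
parse-insertᶜ : ∀ n f → parse n (insertᶜ f) ≗ insert (parse n f)
group-insertᶜ : ∀ n φ l →
  insertᴮ (group n φ) l ≡ parse n (φ 0 true) (ne l) + group n (insertOnᶜ φ) l

parse-insertᶜ zero    f ε      = refl
parse-insertᶜ zero    f (ne l) = sym (vanish splitᴮ-linear (false ∷ l))
parse-insertᶜ (suc n) f ε      = trans (parse-add n _ (f ∘ (ones 0 true ∷_)) ε)
  (cong (_+ parse n (f ∘ (ones 0 true ∷_)) ε) (parse-insertᶜ n (f ∘ (blank ∷_)) ε))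
parse-insertᶜ (suc n) f (ne l) = begin
  parse n (insertᶜ f ∘ (blank ∷_)) (ne l) + group n (insertOnᶜ φ) l
    ≡⟨ cong (_+ group n (insertOnᶜ φ) l) (parse-add n _ (φ 0 true) (ne l)) ⟩
  (parse n (insertᶜ f₀) (ne l) + parse n (φ 0 true) (ne l)) + group n (insertOnᶜ φ) l
    ≡⟨ +-assoc (parse n (insertᶜ f₀) (ne l)) _ _ ⟩
  parse n (insertᶜ f₀) (ne l) + (parse n (φ 0 true) (ne l) + group n (insertOnᶜ φ) l)
    ≡⟨ cong₂ _+_ (parse-insertᶜ n f₀ (ne l)) (sym (group-insertᶜ n φ l)) ⟩
  insertᴮ (parse n f₀ ∘ ne) l + insertᴮ (group n φ) l
    ≡⟨ add splitᴮ-linear (parse n f₀ ∘ ne) (group n φ) (false ∷ l) ⟨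
  insert (parse (suc n) f) (ne l) ∎
  where
  open ≡-Reasoning
  f₀ : Weight
  f₀ = f ∘ (blank ∷_)
  φ : ℕ → Bool → Weight
  φ u b s = f (ones u b ∷ s)

group-insertᶜ n φ [] = cong (parse n (φ 0 true) (ne []) +_)
  (trans (cong (_+ parse n (φ 1 true) ε) (parse-belowᶜ-ε n (φ 0 false)))
         (sym (parse-add n _ (φ 1 true) ε)))
group-insertᶜ n φ (true ∷ l) = cong (parse n (φ 0 true) (ne (true ∷ l)) +_)
  (trans (cong (_+ parse n (φ 1 true) (ne l)) (parse-belowᶜ-ne n (φ 0 false) l))
         (sym (parse-add n _ (φ 1 true) (ne l))))
group-insertᶜ n φ (false ∷ l) = cong (parse n (φ 0 true) (ne (false ∷ l)) +_) (begin
  insertᴮ (λ l → parse n (φ 0 false) (ne l) + group n (φ ∘ suc) l) l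
    ≡⟨ add splitᴮ-linear (parse n (φ 0 false) ∘ ne) (group n (φ ∘ suc)) (false ∷ l) ⟩
  insertᴮ (parse n (φ 0 false) ∘ ne) l + insertᴮ (group n (φ ∘ suc)) l
    ≡⟨ cong₂ _+_ (sym (parse-insertᶜ n (φ 0 false) (ne l))) (group-insertᶜ n (φ ∘ suc) l) ⟩
  parse n (insertᶜ (φ 0 false)) (ne l) + (parse n (φ 1 true) (ne l) + group n (insertOnᶜ (φ ∘ suc)) l)
    ≡⟨ +-assoc (parse n (insertᶜ (φ 0 false)) (ne l)) _ _ ⟨
  (parse n (insertᶜ (φ 0 false)) (ne l) + parse n (φ 1 true) (ne l)) + group n (insertOnᶜ (φ ∘ suc)) l
    ≡⟨ cong₂ _+_ (sym (parse-add n _ (φ 1 true) (ne l)))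
         (group-ext n (λ { u false s → refl ; u true s → refl }) l) ⟩
  group n (insertOnᶜ φ) (false ∷ l) ∎)
  where open ≡-Reasoning

parse-occupiedᶜ-ε : ∀ n f → parse n (occupiedᶜ f) ε ≡ 0
parse-occupiedᶜ-ε zero    f = refl
parse-occupiedᶜ-ε (suc n) f = parse-occupiedᶜ-ε n (f ∘ (blank ∷_))

parse-occupiedᶜ-ne : ∀ n f l → parse n (occupiedᶜ f) (ne l) ≡ parse n f (ne l)
parse-occupiedᶜ-ne zero    f l = refl
parse-occupiedᶜ-ne (suc n) f l =
  cong (_+ group n (λ u b s → f (ones u b ∷ s)) l) (parse-occupiedᶜ-ne n (f ∘ (blank ∷_)) l)

parse-insert↑ᶜ : ∀ n f → parse n (insert↑ᶜ f) ≗ insert↑ (parse n f)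
group-insert↑ᶜ : ∀ n φ l →
  insert↑ᴮ (group n φ) l ≡ parse n (φ 0 true) (ne l) + group n (insertOn↑ᶜ φ) l

parse-insert↑ᶜ zero    f ε      = refl
parse-insert↑ᶜ zero    f (ne l) = sym (vanish insert↑ᴮ-linear l)
parse-insert↑ᶜ (suc n) f ε      = trans (parse-add n _ _ ε)
  (cong₂ _+_ (parse-insert↑ᶜ n (f ∘ (blank ∷_)) ε) (parse-occupiedᶜ-ε n (f ∘ (ones 0 true ∷_))))
parse-insert↑ᶜ (suc n) f (ne l) = begin
  parse n (insert↑ᶜ f ∘ (blank ∷_)) (ne l) + group n (insertOn↑ᶜ φ) l
    ≡⟨ cong (_+ group n (insertOn↑ᶜ φ) l) (trans (parse-add n _ (occupiedᶜ (φ 0 true)) (ne l))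
         (cong (parse n (insert↑ᶜ f₀) (ne l) +_) (parse-occupiedᶜ-ne n (φ 0 true) l))) ⟩
  (parse n (insert↑ᶜ f₀) (ne l) + parse n (φ 0 true) (ne l)) + group n (insertOn↑ᶜ φ) l
    ≡⟨ +-assoc (parse n (insert↑ᶜ f₀) (ne l)) _ _ ⟩
  parse n (insert↑ᶜ f₀) (ne l) + (parse n (φ 0 true) (ne l) + group n (insertOn↑ᶜ φ) l)
    ≡⟨ cong₂ _+_ (parse-insert↑ᶜ n f₀ (ne l)) (sym (group-insert↑ᶜ n φ l)) ⟩
  insert↑ᴮ (parse n f₀ ∘ ne) l + insert↑ᴮ (group n φ) l
    ≡⟨ add insert↑ᴮ-linear (parse n f₀ ∘ ne) (group n φ) l ⟨
  insert↑ (parse (suc n) f) (ne l) ∎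
  where
  open ≡-Reasoning
  f₀ : Weight
  f₀ = f ∘ (blank ∷_)
  φ : ℕ → Bool → Weight
  φ u b s = f (ones u b ∷ s)

group-insert↑ᶜ n φ [] = sym (trans
  (cong (parse n (φ 0 true) (ne []) +_) (vanish (parse-linear n) ε)) (+-identityʳ _))
group-insert↑ᶜ n φ (true ∷ l) = sym (trans
  (cong (parse n (φ 0 true) (ne (true ∷ l)) +_) (vanish (parse-linear n) (ne l))) (+-identityʳ _))
group-insert↑ᶜ n φ (false ∷ l) = cong (parse n (φ 0 true) (ne (false ∷ l)) +_) (begin
  insert↑ᴮ (λ l → parse n (φ 0 false) (ne l) + group n (φ ∘ suc) l) l
    ≡⟨ add insert↑ᴮ-linear (parse n (φ 0 false) ∘ ne) (group n (φ ∘ suc)) l ⟩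
  insert↑ᴮ (parse n (φ 0 false) ∘ ne) l + insert↑ᴮ (group n (φ ∘ suc)) l
    ≡⟨ cong₂ _+_ (sym (parse-insert↑ᶜ n (φ 0 false) (ne l))) (group-insert↑ᶜ n (φ ∘ suc) l) ⟩
  parse n (insert↑ᶜ (φ 0 false)) (ne l) + (parse n (φ 1 true) (ne l) + group n (insertOn↑ᶜ (φ ∘ suc)) l)
    ≡⟨ +-assoc (parse n (insert↑ᶜ (φ 0 false)) (ne l)) _ _ ⟨
  (parse n (insert↑ᶜ (φ 0 false)) (ne l) + parse n (φ 1 true) (ne l)) + group n (insertOn↑ᶜ (φ ∘ suc)) l
    ≡⟨ cong₂ _+_ (sym (trans (parse-add n _ (occupiedᶜ (φ 1 true)) (ne l))
           (cong (parse n (insert↑ᶜ (φ 0 false)) (ne l) +_) (parse-occupiedᶜ-ne n (φ 1 true) l))))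
         (group-ext n (λ { u false s → refl ; u true s → refl }) l) ⟩
  group n (insertOn↑ᶜ φ) (false ∷ l) ∎)
  where open ≡-Reasoning

popᶜ : ℕ → Weight → Weight
popᶜ q f []      = 0
popᶜ q f (c ∷ s) = gate (q ≡ᵇ tally c) (f s)

-- The unrestricted `pop` is the last in time: the earlier units of the column must leave the block
-- nonempty for the next one.
popAll : ℕ → Operator
popAll zero    F = F
popAll (suc q) F = (pop↑ ^ q) (pop F)

group-popᶜ : ∀ n q f l →
  group n (λ u _ s → gate (q ≡ᵇ u) (f s)) l ≡ (pop↑ ^ q) (pop (parse n f)) (ne l)
group-popᶜ n zero    f []          = refl
group-popᶜ n (suc q) f []          = vanish (parse-linear n) ε
group-popᶜ n zero    f (true ∷ l)  = refl
group-popᶜ n (suc q) f (true ∷ l)  = vanish (parse-linear n) (ne l)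
group-popᶜ n zero    f (false ∷ l) =
  trans (cong (parse n f (ne l) +_) (group-zero n (λ _ _ _ → refl) l)) (+-identityʳ _)
group-popᶜ n (suc q) f (false ∷ l) =
  cong₂ _+_ (vanish (parse-linear n) (ne l)) (group-popᶜ n q f l)

popAll-ε : ∀ q F → popAll (suc q) F ε ≡ 0
popAll-ε zero    F = refl
popAll-ε (suc q) F = refl

parse-popᶜ : ∀ n q f → parse (suc n) (popᶜ q f) ≗ popAll q (parse n f)
parse-popᶜ n zero    f ε      = refl
parse-popᶜ n (suc q) f ε      = trans (vanish (parse-linear n) ε) (sym (popAll-ε q (parse n f)))
parse-popᶜ n zero    f (ne l) =
  trans (cong (parse n f (ne l) +_) (group-zero n (λ _ _ _ → refl) l)) (+-identityʳ _)
parse-popᶜ n (suc q) f (ne l) =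
  cong₂ _+_ (vanish (parse-linear n) (ne l)) (group-popᶜ n q f l)

after : (Weight → Weight) → ℕ → Weight → Weight
after O zero    f = f
after O (suc p) f = O ((insert↑ᶜ ^ p) f)

rowᶜ : ℕ → Weight → Weight
rowᶜ = after insertᶜ

-- The leftmost 1 of the row is placed freely and starts the last block; each further one must go
-- strictly above the start of that block, that is, to its right.
insertAll : ℕ → Operator
insertAll zero    F = F
insertAll (suc p) F = insert ((insert↑ ^ p) F)

parse-insert↑ᶜ^ : ∀ n k f → parse n ((insert↑ᶜ ^ k) f) ≗ (insert↑ ^ k) (parse n f)
parse-insert↑ᶜ^ n zero    f x = refl
parse-insert↑ᶜ^ n (suc k) f x =
  trans (parse-insert↑ᶜ n ((insert↑ᶜ ^ k) f) x) (ext insert↑-linear (parse-insert↑ᶜ^ n k f) x)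

parse-rowᶜ : ∀ n p f → parse n (rowᶜ p f) ≗ insertAll p (parse n f)
parse-rowᶜ n zero    f x = refl
parse-rowᶜ n (suc p) f x =
  trans (parse-insertᶜ n ((insert↑ᶜ ^ p) f) x) (ext insert-linear (parse-insert↑ᶜ^ n p f) x)

popAll-linear : ∀ q → Linear (popAll q)
popAll-linear zero    = idᴸ
popAll-linear (suc q) = powᴸ pop↑-linear q ∘ᴸ pop-linear

insertAll-linear : ∀ p → Linear (insertAll p)
insertAll-linear zero    = idᴸ
insertAll-linear (suc p) = insert-linear ∘ᴸ powᴸ insert↑-linear p

blanks : ℕ → List Column
blanks n = replicate n blank

parse-ε : ∀ n f → parse n f ε ≡ f (blanks n)
parse-ε zero    f = refl
parse-ε (suc n) f = parse-ε n (f ∘ (blank ∷_))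

module _ (q : ℕ → ℕ) where

  popsᶜ : ℕ → ℕ → Weight → Weight
  popsᶜ m zero    f = f
  popsᶜ m (suc d) f = popᶜ (q (m + d)) (popsᶜ m d f)

  pops : ℕ → ℕ → Operator
  pops m zero    F = F
  pops m (suc d) F = popAll (q (m + d)) (pops m d F)

  pops-linear : ∀ m d → Linear (pops m d)
  pops-linear m zero    = idᴸ
  pops-linear m (suc d) = popAll-linear (q (m + d)) ∘ᴸ pops-linear m d

  parse-popsᶜ : ∀ m d f → parse (m + d) (popsᶜ m d f) ≗ pops m d (parse m f)
  parse-popsᶜ m zero    f x rewrite +-identityʳ m = refl
  parse-popsᶜ m (suc d) f x rewrite +-suc m d =
    trans (parse-popᶜ (m + d) (q (m + d)) (popsᶜ m d f) x)
          (ext (popAll-linear (q (m + d))) (parse-popsᶜ m d f) x)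

  finalᶜ : Weight
  finalᶜ []      = 1
  finalᶜ (_ ∷ _) = 0

  -- Columns are retired before the row that no longer reaches them. From this row on they can
  -- neither gain a 1 nor lie in a forbidden triple with the new ones, since its rightmost column
  -- must meet the current row.
  processᶜ : ℕ → List ℕ → (ℕ → ℕ) → Weight
  processᶜ n []       p = popsᶜ 0 n finalᶜ
  processᶜ n (m ∷ ms) p = popsᶜ m (n ∸ m) (rowᶜ (p 0) (processᶜ m ms (p ∘ suc)))

  process : ℕ → List ℕ → (ℕ → ℕ) → Functional
  process n []       p = pops 0 n δ
  process n (m ∷ ms) p = pops m (n ∸ m) (insertAll (p 0) (process m ms (p ∘ suc)))

  parse-finalᶜ : parse 0 finalᶜ ≗ δ
  parse-finalᶜ ε      = refl
  parse-finalᶜ (ne _) = refl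

  parse-processᶜ : ∀ n ms p → Linked _≥_ (n ∷ ms) → parse n (processᶜ n ms p) ≗ process n ms p
  parse-processᶜ n []       p _  x = trans (parse-popsᶜ 0 n finalᶜ x) (ext (pops-linear 0 n) parse-finalᶜ x)
  parse-processᶜ n (m ∷ ms) p (m≤n ∷ ms≤m) x = begin
    parse n (popsᶜ m (n ∸ m) f) x             ≡⟨ cong (λ k → parse k (popsᶜ m (n ∸ m) f) x) (m+[n∸m]≡n m≤n) ⟨
    parse (m + (n ∸ m)) (popsᶜ m (n ∸ m) f) x ≡⟨ parse-popsᶜ m (n ∸ m) f x ⟩
    pops m (n ∸ m) (parse m f) x              ≡⟨ ext (pops-linear m (n ∸ m)) inner x ⟩
    process n (m ∷ ms) p x                    ∎
    where
    open ≡-Reasoning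
    f : Weight
    f = rowᶜ (p 0) (processᶜ m ms (p ∘ suc))
    inner : parse m f ≗ insertAll (p 0) (process m ms (p ∘ suc))
    inner y = trans (parse-rowᶜ m (p 0) _ y)
      (ext (insertAll-linear (p 0)) (parse-processᶜ m ms (p ∘ suc) ms≤m) y)

  processᶜ-blanks : ∀ n ms p → Linked _≥_ (n ∷ ms) → processᶜ n ms p (blanks n) ≡ process n ms p ε
  processᶜ-blanks n ms p desc = trans (sym (parse-ε n _)) (parse-processᶜ n ms p desc ε)

-- Rows of bits

total : ∀ {A : Set} → List A → (A → ℕ) → ℕ
total []       f = 0
total (x ∷ xs) f = f x + total xs f

module _ {A : Set} where

  total-ext : ∀ (xs : List A) {f h} → f ≗ h → total xs f ≡ total xs h
  total-ext []       f≗h = refl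
  total-ext (x ∷ xs) f≗h = cong₂ _+_ (f≗h x) (total-ext xs f≗h)

  total-zero : ∀ (xs : List A) {f} → (∀ x → f x ≡ 0) → total xs f ≡ 0
  total-zero []       f≡0 = refl
  total-zero (x ∷ xs) f≡0 = cong₂ _+_ (f≡0 x) (total-zero xs f≡0)

  total-++ : ∀ (xs ys : List A) f → total (xs ++ ys) f ≡ total xs f + total ys f
  total-++ []       ys f = refl
  total-++ (x ∷ xs) ys f = trans (cong (f x +_) (total-++ xs ys f)) (sym (+-assoc (f x) _ _))

  total-gate : ∀ b (xs : List A) f → total xs (gate b ∘ f) ≡ gate b (total xs f)
  total-gate true  xs f = refl
  total-gate false xs f = total-zero xs (λ _ → refl)

  total-map : ∀ {B : Set} (g : B → A) ys f → total (map g ys) f ≡ total ys (f ∘ g)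
  total-map g []       f = refl
  total-map g (y ∷ ys) f = cong (f (g y) +_) (total-map g ys f)

  total-cartesian : ∀ {B C : Set} (g : B → C → A) xs ys f →
    total (cartesianProductWith g xs ys) f ≡ total xs (λ x → total ys (λ y → f (g x y)))
  total-cartesian g []       ys f = refl
  total-cartesian g (x ∷ xs) ys f = trans (total-++ (map (g x) ys) _ f)
    (cong₂ _+_ (total-map (g x) ys f) (total-cartesian g xs ys f))

total-bits : ∀ n (f : Vec Bool (suc n) → ℕ) →
  total (bitVectors (suc n)) f ≡ total (bitVectors n) (f ∘ (false ∷_)) + total (bitVectors n) (f ∘ (true ∷_))
total-bits n f = trans (total-cartesian _∷_ (false ∷ true ∷ []) (bitVectors n) f)
  (cong (total (bitVectors n) (f ∘ (false ∷_)) +_) (+-identityʳ _))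

bit : Bool → ℕ
bit true  = 1
bit false = 0

weight : ∀ {n} → Vec Bool n → ℕ
weight []      = 0
weight (b ∷ v) = bit b + weight v

zeros : ∀ n → Vec Bool n
zeros n = Vec.replicate n false

weight-zeros : ∀ n → weight (zeros n) ≡ 0
weight-zeros zero    = refl
weight-zeros (suc n) = weight-zeros n

total-zeros : ∀ n (f : Vec Bool n → ℕ) → total (bitVectors n) (λ v → gate (0 ≡ᵇ weight v) (f v)) ≡ f (zeros n)
total-zeros zero    f = +-identityʳ (f [])
total-zeros (suc n) f = trans (total-bits n _)
  (trans (cong₂ _+_ (total-zeros n (f ∘ (false ∷_))) (total-zero (bitVectors n) (λ _ → refl)))
         (+-identityʳ _))

-- admits s v says that the ones of the row v may be added to s; clear s v says that no 1 of s
-- lies in or to the right of the column of the leftmost 1 of v.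
clear admits : List Column → ∀ {n} → Vec Bool n → Bool
clear (blank ∷ s)    (_ ∷ v) = clear s v
clear (ones _ _ ∷ s) v       = weight v ≡ᵇ 0
clear _              _       = true

admits (blank ∷ s)        (_ ∷ v) = admits s v
admits (ones _ false ∷ s) (_ ∷ v) = admits s v
admits (ones _ true ∷ s)  (_ ∷ v) = clear s v
admits _                  _       = true

update : List Column → ∀ {n} → Vec Bool n → List Column
update (blank ∷ s)    (false ∷ v) = blank ∷ update s v
update (blank ∷ s)    (true ∷ v)  = ones 0 true ∷ update s v
update (ones u b ∷ s) (false ∷ v) = ones u (b ∧ (weight v ≡ᵇ 0)) ∷ update s v
update (ones u _ ∷ s) (true ∷ v)  = ones (suc u) true ∷ update s v
update s              _           = s

length-update : ∀ s {n} (v : Vec Bool n) → length (update s v) ≡ length s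
length-update []             _           = refl
length-update (blank ∷ s)    []          = refl
length-update (ones _ _ ∷ s) []          = refl
length-update (blank ∷ s)    (false ∷ v) = cong suc (length-update s v)
length-update (blank ∷ s)    (true ∷ v)  = cong suc (length-update s v)
length-update (ones _ _ ∷ s) (false ∷ v) = cong suc (length-update s v)
length-update (ones _ _ ∷ s) (true ∷ v)  = cong suc (length-update s v)

clear-zeros : ∀ s n → clear s (zeros n) ≡ true
clear-zeros []             n       = refl
clear-zeros (blank ∷ s)    zero    = refl
clear-zeros (blank ∷ s)    (suc n) = clear-zeros s n
clear-zeros (ones _ _ ∷ s) n       = cong (_≡ᵇ 0) (weight-zeros n)

admits-zeros : ∀ s n → admits s (zeros n) ≡ true
admits-zeros []                 n       = refl
admits-zeros (blank ∷ s)        zero    = refl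
admits-zeros (blank ∷ s)        (suc n) = admits-zeros s n
admits-zeros (ones _ false ∷ s) zero    = refl
admits-zeros (ones _ false ∷ s) (suc n) = admits-zeros s n
admits-zeros (ones _ true ∷ s)  zero    = refl
admits-zeros (ones _ true ∷ s)  (suc n) = clear-zeros s n

update-zeros : ∀ s n → update s (zeros n) ≡ s
update-zeros []                 n       = refl
update-zeros (blank ∷ s)        zero    = refl
update-zeros (blank ∷ s)        (suc n) = cong (blank ∷_) (update-zeros s n)
update-zeros (ones u b ∷ s)     zero    = refl
update-zeros (ones u false ∷ s) (suc n) = cong (ones u false ∷_) (update-zeros s n)
update-zeros (ones u true ∷ s)  (suc n) =
  cong₂ (λ b t → ones u b ∷ t) (cong (_≡ᵇ 0) (weight-zeros n)) (update-zeros s n)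

belowᶜ-ext : ∀ {f h} → f ≗ h → belowᶜ f ≗ belowᶜ h
belowᶜ-ext f≗h []             = refl
belowᶜ-ext f≗h (blank ∷ s)    = cong₂ _+_ (belowᶜ-ext (f≗h ∘ (blank ∷_)) s) (f≗h _)
belowᶜ-ext f≗h (ones _ _ ∷ s) = refl

belowᶜ-add : ∀ f h → belowᶜ (λ s → f s + h s) ≗ λ s → belowᶜ f s + belowᶜ h s
belowᶜ-add f h []             = refl
belowᶜ-add f h (blank ∷ s)    = trans
  (cong (_+ (f (ones 0 true ∷ s) + h (ones 0 true ∷ s))) (belowᶜ-add (f ∘ (blank ∷_)) (h ∘ (blank ∷_)) s))
  (interchange (belowᶜ (f ∘ (blank ∷_)) s) _ _ _)
belowᶜ-add f h (ones _ _ ∷ s) = refl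

belowᶜ-linear : Linear belowᶜ
belowᶜ-linear = record { ext = belowᶜ-ext ; add = belowᶜ-add }

occupiedᶜ-ext : ∀ {f h} → f ≗ h → occupiedᶜ f ≗ occupiedᶜ h
occupiedᶜ-ext f≗h []             = refl
occupiedᶜ-ext f≗h (blank ∷ s)    = occupiedᶜ-ext (f≗h ∘ (blank ∷_)) s
occupiedᶜ-ext f≗h (ones _ _ ∷ s) = f≗h _

occupiedᶜ-add : ∀ f h → occupiedᶜ (λ s → f s + h s) ≗ λ s → occupiedᶜ f s + occupiedᶜ h s
occupiedᶜ-add f h []             = refl
occupiedᶜ-add f h (blank ∷ s)    = occupiedᶜ-add (f ∘ (blank ∷_)) (h ∘ (blank ∷_)) s
occupiedᶜ-add f h (ones _ _ ∷ s) = refl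

occupiedᶜ-linear : Linear occupiedᶜ
occupiedᶜ-linear = record { ext = occupiedᶜ-ext ; add = occupiedᶜ-add }

insertᶜ-ext : ∀ {f h} → f ≗ h → insertᶜ f ≗ insertᶜ h
insertᶜ-ext f≗h []                 = refl
insertᶜ-ext f≗h (blank ∷ s)        = cong₂ _+_ (insertᶜ-ext (f≗h ∘ (blank ∷_)) s) (f≗h _)
insertᶜ-ext f≗h (ones u false ∷ s) = cong₂ _+_ (insertᶜ-ext (f≗h ∘ (ones u false ∷_)) s) (f≗h _)
insertᶜ-ext f≗h (ones u true ∷ s)  = cong₂ _+_ (belowᶜ-ext (f≗h ∘ (ones u false ∷_)) s) (f≗h _)

insertᶜ-add : ∀ f h → insertᶜ (λ s → f s + h s) ≗ λ s → insertᶜ f s + insertᶜ h s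
insertᶜ-add f h []                 = refl
insertᶜ-add f h (blank ∷ s)        = trans
  (cong (_+ (f (ones 0 true ∷ s) + h (ones 0 true ∷ s))) (insertᶜ-add (f ∘ (blank ∷_)) (h ∘ (blank ∷_)) s))
  (interchange (insertᶜ (f ∘ (blank ∷_)) s) _ _ _)
insertᶜ-add f h (ones u false ∷ s) = trans
  (cong (_+ (f (ones (suc u) true ∷ s) + h (ones (suc u) true ∷ s)))
    (insertᶜ-add (f ∘ (ones u false ∷_)) (h ∘ (ones u false ∷_)) s))
  (interchange (insertᶜ (f ∘ (ones u false ∷_)) s) _ _ _)
insertᶜ-add f h (ones u true ∷ s)  = trans
  (cong (_+ (f (ones (suc u) true ∷ s) + h (ones (suc u) true ∷ s)))
    (belowᶜ-add (f ∘ (ones u false ∷_)) (h ∘ (ones u false ∷_)) s))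
  (interchange (belowᶜ (f ∘ (ones u false ∷_)) s) _ _ _)

insertᶜ-linear : Linear insertᶜ
insertᶜ-linear = record { ext = insertᶜ-ext ; add = insertᶜ-add }

insert↑ᶜ-ext : ∀ {f h} → f ≗ h → insert↑ᶜ f ≗ insert↑ᶜ h
insert↑ᶜ-ext f≗h []                 = refl
insert↑ᶜ-ext f≗h (blank ∷ s)        =
  cong₂ _+_ (insert↑ᶜ-ext (f≗h ∘ (blank ∷_)) s) (occupiedᶜ-ext (f≗h ∘ (ones 0 true ∷_)) s)
insert↑ᶜ-ext f≗h (ones u false ∷ s) =
  cong₂ _+_ (insert↑ᶜ-ext (f≗h ∘ (ones u false ∷_)) s) (occupiedᶜ-ext (f≗h ∘ (ones (suc u) true ∷_)) s)
insert↑ᶜ-ext f≗h (ones u true ∷ s)  = refl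

insert↑ᶜ-add : ∀ f h → insert↑ᶜ (λ s → f s + h s) ≗ λ s → insert↑ᶜ f s + insert↑ᶜ h s
insert↑ᶜ-add f h []                 = refl
insert↑ᶜ-add f h (blank ∷ s)        = trans
  (cong₂ _+_ (insert↑ᶜ-add (f ∘ (blank ∷_)) (h ∘ (blank ∷_)) s)
             (occupiedᶜ-add (f ∘ (ones 0 true ∷_)) (h ∘ (ones 0 true ∷_)) s))
  (interchange (insert↑ᶜ (f ∘ (blank ∷_)) s) _ _ _)
insert↑ᶜ-add f h (ones u false ∷ s) = trans
  (cong₂ _+_ (insert↑ᶜ-add (f ∘ (ones u false ∷_)) (h ∘ (ones u false ∷_)) s)
             (occupiedᶜ-add (f ∘ (ones (suc u) true ∷_)) (h ∘ (ones (suc u) true ∷_)) s))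
  (interchange (insert↑ᶜ (f ∘ (ones u false ∷_)) s) _ _ _)
insert↑ᶜ-add f h (ones u true ∷ s)  = refl

insert↑ᶜ-linear : Linear insert↑ᶜ
insert↑ᶜ-linear = record { ext = insert↑ᶜ-ext ; add = insert↑ᶜ-add }

-- Free x y: a column x other than the start of a block becomes y when it takes a new 1.
data Free : Column → Column → Set where
  blank  : Free blank (ones 0 true)
  linked : ∀ u → Free (ones u false) (ones (suc u) true)

-- The ones go from left to right and the head is the rightmost column, so it can take only the last
-- of them. That 1 needs an older unit to its left, hence the guard.
insert↑ᶜ^-free : ∀ {x y} → Free x y → ∀ k f s →
  (insert↑ᶜ ^ suc k) f (x ∷ s) ≡
  (insert↑ᶜ ^ suc k) (f ∘ (x ∷_)) s + (insert↑ᶜ ^ k) (occupiedᶜ (f ∘ (y ∷_))) s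
insert↑ᶜ^-free blank      zero f s = refl
insert↑ᶜ^-free (linked u) zero f s = refl
insert↑ᶜ^-free blank      (suc k) f s = trans
  (cong₂ _+_ (trans (ext insert↑ᶜ-linear (insert↑ᶜ^-free blank k f) s) (add insert↑ᶜ-linear _ _ s))
             (vanish occupiedᶜ-linear s))
  (+-identityʳ _)
insert↑ᶜ^-free (linked u) (suc k) f s = trans
  (cong₂ _+_ (trans (ext insert↑ᶜ-linear (insert↑ᶜ^-free (linked u) k f) s) (add insert↑ᶜ-linear _ _ s))
             (vanish occupiedᶜ-linear s))
  (+-identityʳ _)

insert↑ᶜ^-raised : ∀ {x y} → Free x y → ∀ k f s → (insert↑ᶜ ^ suc k) f (y ∷ s) ≡ 0
insert↑ᶜ^-raised blank      k f s = refl
insert↑ᶜ^-raised (linked u) k f s = refl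

-- After any insertion some column is nonempty, so the guard `occupiedᶜ` changes nothing.
Blind : (Weight → Weight) → Set
Blind O = ∀ f → O (occupiedᶜ f) ≗ O f

belowᶜ-blind : Blind belowᶜ
belowᶜ-blind f []             = refl
belowᶜ-blind f (blank ∷ s)    = cong (_+ f (ones 0 true ∷ s)) (belowᶜ-blind (f ∘ (blank ∷_)) s)
belowᶜ-blind f (ones _ _ ∷ s) = refl

insertᶜ-blind : Blind insertᶜ
insertᶜ-blind f []                 = refl
insertᶜ-blind f (blank ∷ s)        = cong (_+ f (ones 0 true ∷ s)) (insertᶜ-blind (f ∘ (blank ∷_)) s)
insertᶜ-blind f (ones _ false ∷ s) = refl
insertᶜ-blind f (ones _ true ∷ s)  = refl

insert↑ᶜ-blind : Blind insert↑ᶜ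
insert↑ᶜ-blind f []                 = refl
insert↑ᶜ-blind f (blank ∷ s)        =
  cong (_+ occupiedᶜ (f ∘ (ones 0 true ∷_)) s) (insert↑ᶜ-blind (f ∘ (blank ∷_)) s)
insert↑ᶜ-blind f (ones _ false ∷ s) = refl
insert↑ᶜ-blind f (ones _ true ∷ s)  = refl

insert↑ᶜ^-blind : ∀ {O} → Linear O → Blind O → ∀ k → Blind (O ∘ (insert↑ᶜ ^ k))
insert↑ᶜ^-blind o blind zero    f s = blind f s
insert↑ᶜ^-blind o blind (suc k) f s = ext o (insert↑ᶜ^-blind insert↑ᶜ-linear insert↑ᶜ-blind k f) s

-- The operators decide first where the leftmost 1 goes, whereas a sum over bit vectors decides
-- first whether the head column gets a 1. A head that takes the first 1 blocks all others, so both
-- orders reduce to whether the last 1 is in the head.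
after-free : ∀ {O x y} → Linear O → Blind O → Free x y → ∀ p f s →
  O ((insert↑ᶜ ^ p) f ∘ (x ∷_)) s + (insert↑ᶜ ^ p) f (y ∷ s) ≡
  after O (suc p) (f ∘ (x ∷_)) s + after O p (f ∘ (y ∷_)) s
after-free o blind free zero    f s = refl
after-free {O} {x} {y} o blind free (suc p) f s = begin
  O ((insert↑ᶜ ^ suc p) f ∘ (x ∷_)) s + (insert↑ᶜ ^ suc p) f (y ∷ s)
    ≡⟨ cong₂ _+_ (ext o (insert↑ᶜ^-free free p f) s) (insert↑ᶜ^-raised free p f s) ⟩
  O (λ s → (insert↑ᶜ ^ suc p) (f ∘ (x ∷_)) s + (insert↑ᶜ ^ p) (occupiedᶜ (f ∘ (y ∷_))) s) s + 0
    ≡⟨ trans (+-identityʳ _) (add o _ _ s) ⟩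
  O ((insert↑ᶜ ^ suc p) (f ∘ (x ∷_))) s + O ((insert↑ᶜ ^ p) (occupiedᶜ (f ∘ (y ∷_)))) s
    ≡⟨ cong (O ((insert↑ᶜ ^ suc p) (f ∘ (x ∷_))) s +_) (insert↑ᶜ^-blind o blind p (f ∘ (y ∷_)) s) ⟩
  O ((insert↑ᶜ ^ suc p) (f ∘ (x ∷_))) s + O ((insert↑ᶜ ^ p) (f ∘ (y ∷_))) s ∎
  where open ≡-Reasoning

gate-≡ᵇ : ∀ p k (φ : ℕ → ℕ) → gate (p ≡ᵇ k) (φ k) ≡ gate (p ≡ᵇ k) (φ p)
gate-≡ᵇ zero    zero    φ = refl
gate-≡ᵇ zero    (suc k) φ = refl
gate-≡ᵇ (suc p) zero    φ = refl
gate-≡ᵇ (suc p) (suc k) φ = gate-≡ᵇ p k (φ ∘ suc)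

rowTotal : (∀ s {n} → Vec Bool n → Bool) → ℕ → Weight → Weight
rowTotal check p f s =
  total (bitVectors (length s)) (λ v → gate (p ≡ᵇ weight v) (gate (check s v) (f (update s v))))

rowTotal-zero : ∀ (check : ∀ s {n} → Vec Bool n → Bool) → (∀ s n → check s (zeros n) ≡ true) →
  ∀ f s → rowTotal check 0 f s ≡ f s
rowTotal-zero check ok f s = trans (total-zeros (length s) (λ v → gate (check s v) (f (update s v))))
  (cong₂ gate (ok s (length s)) (cong f (update-zeros s (length s))))

clear-total : ∀ p f s → rowTotal clear p f s ≡ after belowᶜ p f s
clear-total zero    f s              = rowTotal-zero clear clear-zeros f s
clear-total (suc p) f []             = refl
clear-total (suc p) f (blank ∷ s)    = begin
  rowTotal clear (suc p) f (blank ∷ s)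
    ≡⟨ total-bits (length s) _ ⟩
  rowTotal clear (suc p) (f ∘ (blank ∷_)) s + rowTotal clear p (f ∘ (ones 0 true ∷_)) s
    ≡⟨ cong₂ _+_ (clear-total (suc p) (f ∘ (blank ∷_)) s) (clear-total p (f ∘ (ones 0 true ∷_)) s) ⟩
  after belowᶜ (suc p) (f ∘ (blank ∷_)) s + after belowᶜ p (f ∘ (ones 0 true ∷_)) s
    ≡⟨ after-free belowᶜ-linear belowᶜ-blind blank p f s ⟨
  after belowᶜ (suc p) f (blank ∷ s) ∎
  where open ≡-Reasoning
-- A nonempty head demands weight zero, against the prescribed weight `suc p`.
clear-total (suc p) f (ones u b ∷ s) = total-zero (bitVectors (suc (length s)))
  (λ v → dead (weight v) (f (update (ones u b ∷ s) v)))
  where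
  dead : ∀ k x → gate (suc p ≡ᵇ k) (gate (k ≡ᵇ 0) x) ≡ 0
  dead zero    x = refl
  dead (suc k) x = gate-zero (p ≡ᵇ k)

-- This identifies adding a whole row of bits with repeated single insertion. A marked head hands
-- over to `clear` on one side and to `belowᶜ` on the other.
admits-total : ∀ p f s → rowTotal admits p f s ≡ rowᶜ p f s
admits-total zero    f s           = rowTotal-zero admits admits-zeros f s
admits-total (suc p) f []          = refl
admits-total (suc p) f (blank ∷ s) = begin
  rowTotal admits (suc p) f (blank ∷ s)
    ≡⟨ total-bits (length s) _ ⟩
  rowTotal admits (suc p) (f ∘ (blank ∷_)) s + rowTotal admits p (f ∘ (ones 0 true ∷_)) s
    ≡⟨ cong₂ _+_ (admits-total (suc p) (f ∘ (blank ∷_)) s)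
         (admits-total p (f ∘ (ones 0 true ∷_)) s) ⟩
  after insertᶜ (suc p) (f ∘ (blank ∷_)) s + after insertᶜ p (f ∘ (ones 0 true ∷_)) s
    ≡⟨ after-free insertᶜ-linear insertᶜ-blind blank p f s ⟨
  rowᶜ (suc p) f (blank ∷ s) ∎
  where
  open ≡-Reasoning
admits-total (suc p) f (ones u false ∷ s) = begin
  rowTotal admits (suc p) f (ones u false ∷ s)
    ≡⟨ total-bits (length s) _ ⟩
  rowTotal admits (suc p) (f ∘ (ones u false ∷_)) s + rowTotal admits p (f ∘ (ones (suc u) true ∷_)) s
    ≡⟨ cong₂ _+_ (admits-total (suc p) (f ∘ (ones u false ∷_)) s)
         (admits-total p (f ∘ (ones (suc u) true ∷_)) s) ⟩
  after insertᶜ (suc p) (f ∘ (ones u false ∷_)) s + after insertᶜ p (f ∘ (ones (suc u) true ∷_)) s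
    ≡⟨ after-free insertᶜ-linear insertᶜ-blind (linked u) p f s ⟨
  rowᶜ (suc p) f (ones u false ∷ s) ∎
  where
  open ≡-Reasoning
admits-total (suc p) f (ones u true ∷ s) = begin
  rowTotal admits (suc p) f (ones u true ∷ s)
    ≡⟨ total-bits (length s) _ ⟩
  total (bitVectors (length s)) (λ v → gate (suc p ≡ᵇ weight v)
      (gate (clear s v) (f (ones u (weight v ≡ᵇ 0) ∷ update s v))))
    + rowTotal clear p (f ∘ (ones (suc u) true ∷_)) s
    -- Inside the gate the weight is `suc p`, so the mark of the head evaluates to `false`.
    ≡⟨ cong (_+ rowTotal clear p (f ∘ (ones (suc u) true ∷_)) s) (total-ext (bitVectors (length s))
         (λ v → gate-≡ᵇ (suc p) (weight v) (λ k → gate (clear s v) (f (ones u (k ≡ᵇ 0) ∷ update s v))))) ⟩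
  rowTotal clear (suc p) (f ∘ (ones u false ∷_)) s + rowTotal clear p (f ∘ (ones (suc u) true ∷_)) s
    ≡⟨ cong₂ _+_ (clear-total (suc p) (f ∘ (ones u false ∷_)) s) (clear-total p (f ∘ (ones (suc u) true ∷_)) s) ⟩
  after belowᶜ (suc p) (f ∘ (ones u false ∷_)) s + after belowᶜ p (f ∘ (ones (suc u) true ∷_)) s
    ≡⟨ after-free belowᶜ-linear belowᶜ-blind (linked u) p f s ⟨
  rowᶜ (suc p) f (ones u true ∷ s) ∎
  where open ≡-Reasoning

-- Scanning a whole filling

gate-∧ : ∀ a b x → gate (a ∧ b) x ≡ gate a (gate b x)
gate-∧ true  b x = refl
gate-∧ false b x = refl

module _ (q : ℕ → ℕ) where

  fits : ℕ → ℕ → List Column → Bool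
  fits m zero    s       = true
  fits m (suc d) []      = false
  fits m (suc d) (c ∷ s) = (q (m + d) ≡ᵇ tally c) ∧ fits m d s

  popsᶜ-fits : ∀ m d f s → popsᶜ q m d f s ≡ gate (fits m d s) (f (drop d s))
  popsᶜ-fits m zero    f s       = refl
  popsᶜ-fits m (suc d) f []      = refl
  popsᶜ-fits m (suc d) f (c ∷ s) = trans
    (cong (gate (q (m + d) ≡ᵇ tally c)) (popsᶜ-fits m d f s))
    (sym (gate-∧ (q (m + d) ≡ᵇ tally c) (fits m d s) _))

  accepts : ∀ {ms} → ℕ → List Column → (ℕ → ℕ) → Filling ms → Bool
  accepts n s p []                 = fits 0 n s
  accepts n s p (_∷_ {x = m} v F) =
    fits m (n ∸ m) s ∧ (p 0 ≡ᵇ weight v) ∧ admits t v ∧ accepts m (update t v) (p ∘ suc) F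
    where t = drop (n ∸ m) s

  length-drop-∸ : ∀ {n m} (s : List Column) → length s ≡ n → m ≤ n → length (drop (n ∸ m) s) ≡ m
  length-drop-∸ {n} {m} s refl m≤n =
    trans (length-drop (n ∸ m) s) (m∸[m∸n]≡n m≤n)

  accepts-total : ∀ n ms p s → length s ≡ n → Linked _≥_ (n ∷ ms) →
    total (fillings ms) (λ F → gate (accepts n s p F) 1) ≡ processᶜ q n ms p s
  accepts-total n [] p s len _ = trans (+-identityʳ _)
    (trans (cong (gate (fits 0 n s)) (sym (done n s len))) (sym (popsᶜ-fits 0 n (finalᶜ q) s)))
    where
    done : ∀ n s → length s ≡ n → finalᶜ q (drop n s) ≡ 1
    done zero    []      refl = refl
    done (suc n) (c ∷ s) refl = done n s refl
  accepts-total n (m ∷ ms) p s len (m≤n ∷ desc) = begin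
    total (fillings (m ∷ ms)) (λ F → gate (accepts n s p F) 1)
      ≡⟨ total-cartesian _∷_ (bitVectors m) (fillings ms) _ ⟩
    total (bitVectors m) (λ v → total (fillings ms) (λ F → gate (fit ∧ rest v F) 1))
      ≡⟨ total-ext (bitVectors m) each ⟩
    total (bitVectors m) (gate fit ∘ row)
      ≡⟨ total-gate fit (bitVectors m) row ⟩
    gate fit (total (bitVectors m) row)
      ≡⟨ cong (gate fit) (whole t (length-drop-∸ s len m≤n)) ⟩
    gate fit (rowᶜ (p 0) next t)
      ≡⟨ popsᶜ-fits m (n ∸ m) (rowᶜ (p 0) next) s ⟨
    processᶜ q n (m ∷ ms) p s ∎
    where
    open ≡-Reasoning
    t : List Column
    t = drop (n ∸ m) s
    fit : Bool
    fit = fits m (n ∸ m) s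
    rest : Vec Bool m → Filling ms → Bool
    rest v F = (p 0 ≡ᵇ weight v) ∧ admits t v ∧ accepts m (update t v) (p ∘ suc) F
    next : Weight
    next = processᶜ q m ms (p ∘ suc)
    row : Vec Bool m → ℕ
    row v = gate (p 0 ≡ᵇ weight v) (gate (admits t v) (next (update t v)))
    each : ∀ v → total (fillings ms) (λ F → gate (fit ∧ rest v F) 1) ≡ gate fit (row v)
    each v = begin
      total (fillings ms) (λ F → gate (fit ∧ rest v F) 1)
        ≡⟨ total-ext (fillings ms) (λ F → trans (gate-∧ fit _ 1) (cong (gate fit)
             (trans (gate-∧ (p 0 ≡ᵇ weight v) _ 1) (cong (gate (p 0 ≡ᵇ weight v)) (gate-∧ (admits t v) _ 1))))) ⟩
      total (fillings ms) (gate fit ∘ gate (p 0 ≡ᵇ weight v) ∘ gate (admits t v) ∘ inner)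
        ≡⟨ total-gate fit (fillings ms) _ ⟩
      gate fit (total (fillings ms) (gate (p 0 ≡ᵇ weight v) ∘ gate (admits t v) ∘ inner))
        ≡⟨ cong (gate fit) (trans (total-gate (p 0 ≡ᵇ weight v) (fillings ms) _)
             (cong (gate (p 0 ≡ᵇ weight v)) (trans (total-gate (admits t v) (fillings ms) inner)
               (cong (gate (admits t v)) (accepts-total m ms (p ∘ suc) (update t v)
                 (trans (length-update t v) (length-drop-∸ s len m≤n)) desc))))) ⟩
      gate fit (row v) ∎
      where
      inner : Filling ms → ℕ
      inner F = gate (accepts m (update t v) (p ∘ suc) F) 1
    -- The list is generalised so that its length equation can be matched, which aligns the bit
    -- vectors with those of `rowTotal`.
    whole : ∀ t → length t ≡ m →
      total (bitVectors m) (λ v → gate (p 0 ≡ᵇ weight v) (gate (admits t v) (next (update t v)))) ≡ rowᶜ (p 0) next t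
    whole t refl = admits-total (p 0) next t

-- The columns of a given matrix

∨-true⁻ : ∀ {x y} → x ∨ y ≡ true → x ≡ true ⊎ y ≡ true
∨-true⁻ {true}  eq = inj₁ refl
∨-true⁻ {false} eq = inj₂ eq

∨-trueʳ : ∀ x {y} → y ≡ true → x ∨ y ≡ true
∨-trueʳ x refl = ∨-zeroʳ x

∨-trueˡ : ∀ {x} y → x ≡ true → x ∨ y ≡ true
∨-trueˡ y refl = refl

∧-true⁻ : ∀ {x y} → x ∧ y ≡ true → x ≡ true × y ≡ true
∧-true⁻ {true} eq = refl , eq

∧-true⁺ : ∀ {x y} → x ≡ true → y ≡ true → x ∧ y ≡ true
∧-true⁺ refl eq = eq

clash : ∀ {x} {A : Set} → x ≡ true → x ≡ false → A
clash refl ()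

≡ᵇ-sound : ∀ m n → (m ≡ᵇ n) ≡ true → m ≡ n
≡ᵇ-sound m n eq = ≡ᵇ⇒≡ m n (subst T (sym eq) tt)

≡ᵇ-refl : ∀ n → (n ≡ᵇ n) ≡ true
≡ᵇ-refl zero    = refl
≡ᵇ-refl (suc n) = ≡ᵇ-refl n

toColumn : ℕ → Bool → Column
toColumn zero    b = blank
toColumn (suc u) b = ones u b

tally-toColumn : ∀ k b → tally (toColumn k b) ≡ k
tally-toColumn zero    b = refl
tally-toColumn (suc k) b = refl

module Matrix (X : ℕ → ℕ → Bool) where

  count : ℕ → ℕ → ℕ
  count zero    c = 0
  count (suc i) c = bit (X i c) + count i c

  present : ℕ → ℕ → Bool
  present zero    c = false
  present (suc i) c = X i c ∨ present i c

  -- Below row i, some 1 of column a lies weakly lower than some 1 of column b.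
  bad : ℕ → ℕ → ℕ → Bool
  bad zero    a b = false
  bad (suc i) a b = bad i a b ∨ (X i b ∧ present (suc i) a)

  -- A nonempty column continues a block exactly when all its ones lie strictly lower than those of
  -- the next nonempty column a to its left, that is, when bad i a c fails.
  flag : ℕ → ℕ → ℕ → Bool
  flag i zero    c = true
  flag i (suc n) c = if present i n then bad i n c else flag i n c

  state : ℕ → ℕ → List Column
  state i zero    = []
  state i (suc n) = toColumn (count i n) (flag i n n) ∷ state i n

  row : ℕ → ∀ n → Vec Bool n
  row i zero    = []
  row i (suc n) = X i n ∷ row i n

  RowAvoids : ℕ → ℕ → Set
  RowAvoids i n = ∀ {a b c} → a ≤ b → b < c → c < n → X i a ≡ true → bad i b c ≡ false

  count-absent : ∀ i c → count i c ≡ 0 → present i c ≡ false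
  count-absent zero    c eq = refl
  count-absent (suc i) c eq with X i c
  ... | false = count-absent i c eq

  count-present : ∀ i c {u} → count i c ≡ suc u → present i c ≡ true
  count-present (suc i) c eq with X i c
  ... | true  = refl
  ... | false = count-present i c eq

  bad-left : ∀ i {a b} → bad i a b ≡ true → present i a ≡ true
  bad-left (suc i) {a} {b} eq with ∨-true⁻ {bad i a b} eq
  ... | inj₁ old = ∨-trueʳ (X i a) (bad-left i old)
  ... | inj₂ new = proj₂ (∧-true⁻ {X i b} new)

  bad-right : ∀ i {a b} → bad i a b ≡ true → present i b ≡ true
  bad-right (suc i) {a} {b} eq with ∨-true⁻ {bad i a b} eq
  ... | inj₁ old = ∨-trueʳ (X i b) (bad-right i old)
  ... | inj₂ new = ∨-trueˡ (present i b) (proj₁ (∧-true⁻ {X i b} new))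

  bad-absent : ∀ i {a b} → present i a ≡ false → bad i a b ≡ false
  bad-absent i {a} {b} absent with bad i a b in eq
  ... | false = refl
  ... | true  = clash (bad-left i eq) absent

  -- A pair is bad when the lowest 1 of the left column is no higher than the highest 1 of the right
  -- one. If `c` lies entirely below `a`, its ones are below the highest 1 of `b`. This lets marks
  -- between neighbours control all pairs.
  bad-split : ∀ i {a b c} → bad i a b ≡ true → present i c ≡ true → bad i a c ≡ true ⊎ bad i c b ≡ true
  bad-split (suc i) {a} {b} {c} eq pc with ∨-true⁻ {bad i a b} eq
  ... | inj₂ new =
    inj₂ (∨-trueʳ (bad i c b) (∧-true⁺ (proj₁ (∧-true⁻ {X i b} new)) pc))
  ... | inj₁ old with ∨-true⁻ {X i c} pc
  ...   | inj₁ now = inj₁ (∨-trueʳ (bad i a c) (∧-true⁺ now (∨-trueʳ (X i a) (bad-left i old))))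
  ...   | inj₂ before with bad-split i old before
  ...     | inj₁ ac = inj₁ (∨-trueˡ (X i c ∧ present (suc i) a) ac)
  ...     | inj₂ cb = inj₂ (∨-trueˡ (X i b ∧ present (suc i) c) cb)

  row-empty : ∀ i n → (weight (row i n) ≡ᵇ 0) ≡ true → ∀ {a} → a < n → X i a ≡ false
  row-empty i (suc n) eq a<n with X i n in Xn | m<1+n⇒m<n∨m≡n a<n
  ... | false | inj₁ a<n′  = row-empty i n eq a<n′
  ... | false | inj₂ refl  = Xn

  row-empty⁻ : ∀ i n → (∀ {a} → a < n → X i a ≡ false) → (weight (row i n) ≡ᵇ 0) ≡ true
  row-empty⁻ i zero    none = refl
  row-empty⁻ i (suc n) none rewrite none {n} ≤-refl = row-empty⁻ i n (none ∘ m<n⇒m<1+n)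

  row-nonempty : ∀ i n → (weight (row i n) ≡ᵇ 0) ≡ false → ∃ λ a → a < n × X i a ≡ true
  row-nonempty i (suc n) eq with X i n in Xn
  ... | true  = n , ≤-refl , Xn
  ... | false with a , a<n , Xa ← row-nonempty i n eq = a , m<n⇒m<1+n a<n , Xa

  Clear : ℕ → ℕ → Set
  Clear i n = ∀ {a b} → a ≤ b → b < n → X i a ≡ true → present i b ≡ false

  clear-sound : ∀ i n → clear (state i n) (row i n) ≡ true → Clear i n
  clear-sound i (suc n) eq {a} {b} a≤b b<n Xa with count i n in cnt
  clear-sound i (suc n) eq {a} {b} a≤b b<n Xa | zero with m<1+n⇒m<n∨m≡n b<n
  ... | inj₁ b<n′ = clear-sound i n eq a≤b b<n′ Xa
  ... | inj₂ refl = count-absent i n cnt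
  clear-sound i (suc n) eq {a} {b} a≤b b<n Xa | suc u =
    clash Xa (row-empty i (suc n) eq (≤-<-trans a≤b b<n))

  clear-complete : ∀ i n → Clear i n → clear (state i n) (row i n) ≡ true
  clear-complete i zero    cl = refl
  clear-complete i (suc n) cl with count i n in cnt
  ... | zero  = clear-complete i n (λ a≤b b<n → cl a≤b (m<n⇒m<1+n b<n))
  ... | suc u = row-empty⁻ i (suc n) none
    where
    none : ∀ {a} → a < suc n → X i a ≡ false
    none {a} (s≤s a≤n) with X i a in Xa
    ... | false = refl
    ... | true  = clash (count-present i n cnt) (cl a≤n ≤-refl Xa)

  data Flag (i n c : ℕ) : Bool → Set where
    bottom : (∀ {b} → b < n → present i b ≡ false) → Flag i n c true
    next   : ∀ b → b < n → present i b ≡ true → (∀ {d} → b < d → d < n → present i d ≡ false) →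
             Flag i n c (bad i b c)

  flag-spec : ∀ i n c → Flag i n c (flag i n c)
  flag-spec i zero    c = bottom (λ ())
  flag-spec i (suc n) c with present i n in pn
  ... | true  = next n ≤-refl pn (λ { n<d (s≤s d≤n) → contradiction d≤n (<⇒≱ n<d) })
  ... | false with flag i n c | flag-spec i n c
  ...   | _ | bottom none = bottom (λ b<n → extend none pn (m<1+n⇒m<n∨m≡n b<n))
    where
    extend : ∀ {n b} → (∀ {b} → b < n → present i b ≡ false) → present i n ≡ false →
             b < n ⊎ b ≡ n → present i b ≡ false
    extend none pn (inj₁ b<n)  = none b<n
    extend none pn (inj₂ refl) = pn
  ...   | _ | next b b<n pb none =
    next b (m<n⇒m<1+n b<n) pb (λ b<d d<n → extend none pn b<d (m<1+n⇒m<n∨m≡n d<n))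
    where
    extend : ∀ {n b d} → (∀ {d} → b < d → d < n → present i d ≡ false) → present i n ≡ false →
             b < d → d < n ⊎ d ≡ n → present i d ≡ false
    extend none pn b<d (inj₁ d<n)  = none b<d d<n
    extend none pn b<d (inj₂ refl) = pn

  restrict : ∀ {i n} → RowAvoids i (suc n) → RowAvoids i n
  restrict av a≤b b<c c<n = av a≤b b<c (m<n⇒m<1+n c<n)

  extend-avoids : ∀ {i n} → RowAvoids i n →
    (∀ {a b} → a ≤ b → b < n → X i a ≡ true → bad i b n ≡ false) → RowAvoids i (suc n)
  extend-avoids av new a≤b b<c c<n Xa with m<1+n⇒m<n∨m≡n c<n
  ... | inj₁ c<n′ = av a≤b b<c c<n′ Xa
  ... | inj₂ refl = new a≤b b<c Xa

  below-next : ∀ i {n b d} → present i d ≡ true → d < n →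
    (∀ {e} → b < e → e < n → present i e ≡ false) → d ≤ b
  below-next i pd d<n none = ≮⇒≥ (λ b<d → clash pd (none b<d d<n))

  -- For an unmarked last column, let `d` be its nearest nonempty neighbour on the left. A bad pair
  -- with left member `b` before `d` would by `bad-split` make the pair with `d` bad, which the
  -- induction excludes, or contradict the missing mark.
  admits-sound : ∀ i n → admits (state i n) (row i n) ≡ true → RowAvoids i n
  admits-sound i zero    eq a≤b b<c () Xa
  admits-sound i (suc n) eq with count i n in cnt
  ... | zero = extend-avoids (admits-sound i n eq) new
    where
    new : ∀ {a b} → a ≤ b → b < n → X i a ≡ true → bad i b n ≡ false
    new {b = b} _ _ _ with bad i b n in bn
    ... | false = refl
    ... | true  = clash (bad-right i bn) (count-absent i n cnt)
  ... | suc u with flag i n n | flag-spec i n n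
  ...   | true  | _ = extend-avoids (λ a≤b b<c c<n Xa → bad-absent i (cl a≤b (<-trans b<c c<n) Xa))
                                    (λ a≤b b<n Xa → bad-absent i (cl a≤b b<n Xa))
    where
    cl : Clear i n
    cl = clear-sound i n eq
  ...   | false | fl = extend-avoids av (new fl refl)
    where
    av : RowAvoids i n
    av = admits-sound i n eq
    new : ∀ {f} → Flag i n n f → f ≡ false → ∀ {a b} → a ≤ b → b < n → X i a ≡ true → bad i b n ≡ false
    new (next d d<n pd none) dn {a} {b} a≤b b<n Xa with bad i b n in bn
    ... | false = refl
    ... | true with m≤n⇒m<n∨m≡n (below-next i (bad-left i bn) b<n none) | bad-split i {c = d} bn pd
    ...   | inj₂ refl | _       = clash bn dn
    ...   | inj₁ b<d  | inj₁ bd = clash bd (av a≤b b<d d<n Xa)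
    ...   | inj₁ b<d  | inj₂ db = clash db dn

  -- At a marked column the neighbour `d` and the column itself are a bad pair. A new 1 with a
  -- nonempty column at or right of it, but left of the marked one, would be at or left of `d` and
  -- see this pair.
  admits-complete : ∀ i n → RowAvoids i n → admits (state i n) (row i n) ≡ true
  admits-complete i zero    av = refl
  admits-complete i (suc n) av with count i n
  ... | zero = admits-complete i n (restrict av)
  ... | suc u with flag i n n | flag-spec i n n
  ...   | false | _  = admits-complete i n (restrict av)
  ...   | true  | fl = clear-complete i n (cl fl refl)
    where
    cl : ∀ {f} → Flag i n n f → f ≡ true → Clear i n
    cl (bottom none)        _  a≤b b<n Xa = none b<n
    cl (next d d<n pd none) dn {a} {b} a≤b b<n Xa with present i b in pb
    ... | false = refl
    ... | true  = clash dn (av (≤-trans a≤b (below-next i pb b<n none)) d<n ≤-refl Xa)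

  -- The new 1 is in the topmost row so far, hence weakly above every 1 of the nearest nonempty
  -- column on the left.
  flag-new : ∀ i k n → X i n ≡ true → flag (suc i) k n ≡ true
  flag-new i zero    n Xn = refl
  flag-new i (suc k) n Xn with present (suc i) k in pk
  ... | true  = ∨-trueʳ (bad i k n) (∧-true⁺ Xn refl)
  ... | false = flag-new i k n Xn

  -- A new 1 to the left has the neighbour of column `n` at or right of it; avoidance then says that
  -- this neighbour and `n` are not a bad pair, so the mark disappears.
  flag-old : ∀ i k n → k ≤ n → X i n ≡ false → RowAvoids i (suc n) →
    flag (suc i) k n ≡ flag i k n ∧ (weight (row i k) ≡ᵇ 0)
  flag-old i zero    n k≤n Xn av = refl
  flag-old i (suc k) n k<n Xn av with X i k in Xk
  ... | true  = trans (cong₂ _∨_ (av ≤-refl k<n ≤-refl Xk) (cong (_∧ true) Xn)) (sym (∧-zeroʳ _))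
  ... | false with present i k
  ...   | false = flag-old i k n (<⇒≤ k<n) Xn av
  ...   | true  rewrite Xn with weight (row i k) ≡ᵇ 0 in w
  ...     | true  = trans (∨-identityʳ _) (sym (∧-identityʳ _))
  ...     | false with a , a<k , Xa ← row-nonempty i k w =
    trans (∨-identityʳ _) (trans (av (<⇒≤ a<k) k<n ≤-refl Xa) (sym (∧-zeroʳ _)))

  update-state : ∀ i n → RowAvoids i n → update (state i n) (row i n) ≡ state (suc i) n
  update-state i zero    av = refl
  update-state i (suc n) av with X i n in Xn
  ... | true rewrite flag-new i n n Xn with count i n
  ...   | zero  = cong (ones 0 true ∷_) (update-state i n (restrict av))
  ...   | suc u = cong (ones (suc u) true ∷_) (update-state i n (restrict av))
  update-state i (suc n) av | false rewrite flag-old i n n ≤-refl Xn av with count i n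
  ...   | zero  = cong (blank ∷_) (update-state i n (restrict av))
  ...   | suc u = cong (ones u (flag i n n ∧ (weight (row i n) ≡ᵇ 0)) ∷_) (update-state i n (restrict av))

  module _ (q : ℕ → ℕ) where

    drop-state : ∀ i m d → drop d (state i (m + d)) ≡ state i m
    drop-state i m zero    = cong (state i) (+-identityʳ m)
    drop-state i m (suc d) rewrite +-suc m d = drop-state i m d

    fits-sound : ∀ i m d → fits q m d (state i (m + d)) ≡ true →
      ∀ {c} → m ≤ c → c < m + d → count i c ≡ q c
    fits-sound i m zero    eq m≤c c<m = contradiction m≤c (<⇒≱ (subst (_ <_) (+-identityʳ m) c<m))
    fits-sound i m (suc d) eq {c} m≤c c<m rewrite +-suc m d with ∧-true⁻ {q (m + d) ≡ᵇ _} eq | m<1+n⇒m<n∨m≡n c<m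
    ... | _    , rest | inj₁ c<m′ = fits-sound i m d rest m≤c c<m′
    ... | here , _    | inj₂ refl =
      sym (trans (≡ᵇ-sound (q (m + d)) _ here) (tally-toColumn (count i (m + d)) _))

    fits-complete : ∀ i m d → (∀ {c} → m ≤ c → c < m + d → count i c ≡ q c) →
      fits q m d (state i (m + d)) ≡ true
    fits-complete i m zero    eq = refl
    fits-complete i m (suc d) eq rewrite +-suc m d
      | tally-toColumn (count i (m + d)) (flag i (m + d) (m + d)) | eq (m≤m+n m d) ≤-refl
      | ≡ᵇ-refl (q (m + d)) = fits-complete i m d (λ m≤c c<m → eq m≤c (m<n⇒m<1+n c<m))

    Accepted : ℕ → ℕ → List ℕ → (ℕ → ℕ) → Set
    Accepted i n []       p = ∀ {c} → c < n → count i c ≡ q c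
    Accepted i n (m ∷ ms) p =
      (∀ {c} → m ≤ c → c < n → count i c ≡ q c) × weight (row i m) ≡ p 0 × RowAvoids i m ×
      Accepted (suc i) m ms (p ∘ suc)

    Rows : ℕ → ∀ {ms} → Filling ms → Set
    Rows i []      = ⊤
    Rows i (_∷_ {x = m} v F) = v ≡ row i m × Rows (suc i) F

    accepts-sound : ∀ {ms} i n p (F : Filling ms) → Linked _≥_ (n ∷ ms) → Rows i F →
      accepts q n (state i n) p F ≡ true → Accepted i n ms p
    accepts-sound i n p [] desc tt eq c<n = fits-sound i 0 n eq z≤n c<n
    accepts-sound i n p (_∷_ {x = m} v F) (m≤n ∷ desc) (refl , rows) eq
      -- Writing the old width as `m + d` brings the state into the form that `fits` and
      -- `drop-state` expect.
      with d ← n ∸ m | refl ← m+[n∸m]≡n m≤n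
      with fit , eq₁ ← ∧-true⁻ {fits q m d _} eq
      rewrite drop-state i m d
      with w , eq₂ ← ∧-true⁻ {p 0 ≡ᵇ weight (row i m)} eq₁
      with ad , eq₃ ← ∧-true⁻ {admits (state i m) (row i m)} eq₂
      rewrite update-state i m (admits-sound i m ad) =
        fits-sound i m d fit , sym (≡ᵇ-sound (p 0) _ w) , admits-sound i m ad ,
        accepts-sound (suc i) m (p ∘ suc) F desc rows eq₃
    accepts-complete : ∀ {ms} i n p (F : Filling ms) → Linked _≥_ (n ∷ ms) → Rows i F →
      Accepted i n ms p → accepts q n (state i n) p F ≡ true
    accepts-complete i n p [] desc tt acc = fits-complete i 0 n (λ _ → acc)
    accepts-complete i n p (_∷_ {x = m} v F) (m≤n ∷ desc) (refl , rows) (fit , w , av , rest)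
      with d ← n ∸ m | refl ← m+[n∸m]≡n m≤n
      rewrite drop-state i m d | sym w | ≡ᵇ-refl (weight (row i m)) | admits-complete i m av
            | update-state i m av | fits-complete i m d fit =
      accepts-complete (suc i) m (p ∘ suc) F desc rows rest

-- Paths, conjugate shapes and counting

lookup-injective : ∀ {A : Set} {xs : List A} → Unique xs → ∀ {i j} → lookup xs i ≡ lookup xs j → i ≡ j
lookup-injective (_ ∷ _)    {zero}  {zero}  eq = refl
lookup-injective (x∉ ∷ _)   {zero}  {suc j} eq = contradiction eq (All.lookup x∉ (∈-lookup j))
lookup-injective (x∉ ∷ _)   {suc i} {zero}  eq = contradiction (sym eq) (All.lookup x∉ (∈-lookup i))
lookup-injective (_ ∷ uniq) {suc i} {suc j} eq = cong suc (lookup-injective uniq eq)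

length-injection : ∀ {A B : Set} {xs : List A} {ys : List B} (f : A → B) → Unique xs →
  (∀ {x} → x ∈ xs → f x ∈ ys) → (∀ {x y} → x ∈ xs → y ∈ xs → f x ≡ f y → x ≡ y) →
  length xs ≤ length ys
length-injection {xs = xs} {ys} f uniq f∈ inj = Fin.injective⇒≤ {f = λ i → index (f∈ (∈-lookup i))} λ {i} {j} eq →
  lookup-injective uniq (inj (∈-lookup i) (∈-lookup j)
    (index-injective (setoid _) (f∈ (∈-lookup i)) (f∈ (∈-lookup j)) eq))

module _ {A B : Set} {P : A → Set} {Q : B → Set} (P? : Decidable P) (Q? : Decidable Q) where

  -- The left inverse on `P` makes `f` injective there. Two uses in opposite directions give
  -- equality of the counts.
  filter-≤ : ∀ {xs ys} → Unique xs → (∀ y → y ∈ ys) → (f : A → B) (g : B → A) →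
    (∀ {x} → P x → Q (f x)) → (∀ {x} → P x → g (f x) ≡ x) →
    length (filter P? xs) ≤ length (filter Q? ys)
  filter-≤ {xs} {ys} uniq all f g P⇒Q gf = length-injection f (Unique.filter⁺ P? uniq)
    (λ x∈ → ∈-filter⁺ Q? (all _) (P⇒Q (holds x∈)))
    (λ x∈ y∈ eq → trans (sym (gf (holds x∈))) (trans (cong g eq) (gf (holds y∈))))
    where
    holds : ∀ {x} → x ∈ filter P? xs → P x
    holds = proj₂ ∘ ∈-filter⁻ P? {xs = xs}

total-filter : ∀ {A : Set} (b : A → Bool) xs →
  total xs (λ x → gate (b x) 1) ≡ length (filter (λ x → b x Bool.≟ true) xs)
total-filter b []       = refl
total-filter b (x ∷ xs) with b x
... | true  = cong suc (total-filter b xs)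
... | false = total-filter b xs

souths : ℕ → List Step
souths zero    = []
souths (suc k) = replicate k south↑ ++ south ∷ []

run⃗-++ : ∀ ss ts F → run⃗ (ss ++ ts) F ≡ run⃗ ss (run⃗ ts F)
run⃗-++ []       ts F = refl
run⃗-++ (s ∷ ss) ts F = cong (forward s) (run⃗-++ ss ts F)

run⃖-++ : ∀ ss ts F → run⃖ (ss ++ ts) F ≡ run⃖ ts (run⃖ ss F)
run⃖-++ []       ts F = refl
run⃖-++ (s ∷ ss) ts F = run⃖-++ ss ts (backward s F)

run⃗-souths : ∀ k F → run⃗ (souths k) F ≡ popAll k F
run⃗-souths zero    F = refl
run⃗-souths (suc k) F = go k
  where
  go : ∀ k → run⃗ (replicate k south↑ ++ south ∷ []) F ≡ (pop↑ ^ k) (pop F)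
  go zero    = refl
  go (suc k) = cong pop↑ (go k)

run⃖-replicate : ∀ s k F → run⃖ (replicate k s) F ≡ (backward s ^ k) F
run⃖-replicate s zero    F = refl
run⃖-replicate s (suc k) F = trans (run⃖-replicate s k (backward s F)) (^-shift (backward s) k F)

run⃖-souths : ∀ k F → run⃖ (souths k) F ≡ insertAll k F
run⃖-souths zero    F = refl
run⃖-souths (suc k) F =
  trans (run⃖-++ (replicate k south↑) (south ∷ []) F) (cong insert (run⃖-replicate south↑ k F))

-- The bottom row comes last on the boundary. The vertical edge of a row is replaced by as many
-- south steps as the row has ones.
rowSteps : ℕ → List ℕ → (ℕ → ℕ) → List Step
rowSteps n []       p = replicate n east
rowSteps n (m ∷ ms) p = rowSteps m ms (p ∘ suc) ++ souths (p 0) ++ replicate (n ∸ m) east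

downs : (ℕ → ℕ) → ℕ → ℕ → List Step
downs q m zero    = []
downs q m (suc d) = souths (q (m + d)) ++ downs q m d

-- The same boundary given by column heights: the rows above height `h` end before the next column,
-- and contribute their south steps there, the topmost first.
columnSteps : (ℕ → ℕ) → ℕ → List ℕ → List Step
columnSteps q n []       = downs q 0 n
columnSteps q n (h ∷ hs) = downs q h (n ∸ h) ++ east ∷ columnSteps q h hs

pops-one : ∀ m d F → pops (const 1) m d F ≡ (pop ^ d) F
pops-one m zero    F = refl
pops-one m (suc d) F = cong pop (pops-one m d F)

run⃖-rowSteps : ∀ n ms p → run⃖ (rowSteps n ms p) δ ≡ process (const 1) n ms p
run⃖-rowSteps n []       p = trans (run⃖-replicate east n δ) (sym (pops-one 0 n δ))
run⃖-rowSteps n (m ∷ ms) p = begin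
  run⃖ (rowSteps m ms (p ∘ suc) ++ souths (p 0) ++ replicate (n ∸ m) east) δ
    ≡⟨ run⃖-++ (rowSteps m ms (p ∘ suc)) _ δ ⟩
  run⃖ (souths (p 0) ++ replicate (n ∸ m) east) (run⃖ (rowSteps m ms (p ∘ suc)) δ)
    ≡⟨ run⃖-++ (souths (p 0)) _ _ ⟩
  run⃖ (replicate (n ∸ m) east) (run⃖ (souths (p 0)) (run⃖ (rowSteps m ms (p ∘ suc)) δ))
    ≡⟨ run⃖-replicate east (n ∸ m) _ ⟩
  (pop ^ (n ∸ m)) (run⃖ (souths (p 0)) (run⃖ (rowSteps m ms (p ∘ suc)) δ))
    ≡⟨ cong (pop ^ (n ∸ m)) (run⃖-souths (p 0) _) ⟩
  (pop ^ (n ∸ m)) (insertAll (p 0) (run⃖ (rowSteps m ms (p ∘ suc)) δ))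
    ≡⟨ cong ((pop ^ (n ∸ m)) ∘ insertAll (p 0)) (run⃖-rowSteps m ms (p ∘ suc)) ⟩
  (pop ^ (n ∸ m)) (insertAll (p 0) (process (const 1) m ms (p ∘ suc)))
    ≡⟨ pops-one m (n ∸ m) _ ⟨
  process (const 1) n (m ∷ ms) p ∎
  where open ≡-Reasoning

run⃗-downs : ∀ q m d F → run⃗ (downs q m d) F ≡ pops q m d F
run⃗-downs q m zero    F = refl
run⃗-downs q m (suc d) F = trans (run⃗-++ (souths (q (m + d))) (downs q m d) F)
  (trans (run⃗-souths (q (m + d)) _) (cong (popAll (q (m + d))) (run⃗-downs q m d F)))

run⃗-columnSteps : ∀ q n hs → run⃗ (columnSteps q n hs) δ ≡ process q n hs (const 1)
run⃗-columnSteps q n []       = run⃗-downs q 0 n δ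
run⃗-columnSteps q n (h ∷ hs) = trans (run⃗-++ (downs q h (n ∸ h)) _ δ)
  (trans (run⃗-downs q h (n ∸ h) _) (cong (pops q h (n ∸ h) ∘ insert) (run⃗-columnSteps q h hs)))

-- The recursion removes the bottom row, so it unfolds together with `rowSteps`.
conjugate : List ℕ → List ℕ
conjugate []       = []
conjugate (m ∷ ms) = map suc (conjugate ms) ++ replicate (m ∸ ms ‼ 0) 1

downs-suc : ∀ q m d → downs q (suc m) d ≡ downs (q ∘ suc) m d
downs-suc q m zero    = refl
downs-suc q m (suc d) = cong (souths (q (suc (m + d))) ++_) (downs-suc q m d)

downs-zero : ∀ q d → downs q 0 (suc d) ≡ downs (q ∘ suc) 0 d ++ souths (q 0)
downs-zero q zero    = ++-identityʳ _
downs-zero q (suc d) = trans (cong (souths (q (suc d)) ++_) (downs-zero q d))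
  (sym (++-assoc (souths (q (suc d))) (downs (q ∘ suc) 0 d) (souths (q 0))))

columnSteps-ones : ∀ q d → columnSteps q 1 (replicate d 1) ≡ replicate d east ++ souths (q 0)
columnSteps-ones q zero    = ++-identityʳ _
columnSteps-ones q (suc d) = cong (east ∷_) (columnSteps-ones q d)

-- A new bottom row changes the boundary only at its end: all earlier rows merely shift their index,
-- and the new columns and the ones of the new row follow.
columnSteps-suc : ∀ q n hs d → columnSteps q (suc n) (map suc hs ++ replicate d 1) ≡
  columnSteps (q ∘ suc) n hs ++ replicate d east ++ souths (q 0)
columnSteps-suc q n []       zero    = downs-zero q n
columnSteps-suc q n []       (suc d) =
  cong₂ _++_ (downs-suc q 0 n) (cong (east ∷_) (columnSteps-ones q d))
columnSteps-suc q n (h ∷ hs) d = trans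
  (cong₂ _++_ (downs-suc q h (n ∸ h)) (cong (east ∷_) (columnSteps-suc q h hs d)))
  (sym (++-assoc (downs (q ∘ suc) h (n ∸ h)) _ _))

rowSteps-top : ∀ n ms p → Linked _≥_ ms → ms ‼ 0 ≤ n →
  rowSteps n ms p ≡ rowSteps (ms ‼ 0) ms p ++ replicate (n ∸ ms ‼ 0) east
rowSteps-top n []       p _ _ = refl
rowSteps-top n (m ∷ ms) p _ _ = begin
  inner ++ souths (p 0) ++ replicate (n ∸ m) east
    ≡⟨ cong (λ k → inner ++ k ++ replicate (n ∸ m) east)
         (sym (trans (cong (λ d → souths (p 0) ++ replicate d east) (n∸n≡0 m)) (++-identityʳ _))) ⟩
  inner ++ (souths (p 0) ++ replicate (m ∸ m) east) ++ replicate (n ∸ m) east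
    ≡⟨ ++-assoc inner _ _ ⟨
  (inner ++ souths (p 0) ++ replicate (m ∸ m) east) ++ replicate (n ∸ m) east ∎
  where
  open ≡-Reasoning
  inner : List Step
  inner = rowSteps m ms (p ∘ suc)

linked-tail : ∀ {m ms} → Linked _≥_ (m ∷ ms) → Linked _≥_ ms × ms ‼ 0 ≤ m
linked-tail [-]        = [] , z≤n
linked-tail (m≥ ∷ dec) = dec , m≥

columnSteps≡rowSteps : ∀ q ns → Linked _≥_ ns →
  columnSteps q (length ns) (conjugate ns) ≡ rowSteps (ns ‼ 0) ns q
columnSteps≡rowSteps q []       _   = refl
columnSteps≡rowSteps q (m ∷ ms) dec with dec′ , top ← linked-tail dec = begin
  columnSteps q (suc (length ms)) (conjugate (m ∷ ms))
    ≡⟨ columnSteps-suc q (length ms) (conjugate ms) (m ∸ ms ‼ 0) ⟩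
  columnSteps (q ∘ suc) (length ms) (conjugate ms) ++ easts ++ souths (q 0)
    ≡⟨ cong (_++ easts ++ souths (q 0)) (columnSteps≡rowSteps (q ∘ suc) ms dec′) ⟩
  rowSteps (ms ‼ 0) ms (q ∘ suc) ++ easts ++ souths (q 0)
    ≡⟨ ++-assoc (rowSteps (ms ‼ 0) ms (q ∘ suc)) easts _ ⟨
  (rowSteps (ms ‼ 0) ms (q ∘ suc) ++ easts) ++ souths (q 0)
    ≡⟨ cong₂ _++_ (rowSteps-top m ms (q ∘ suc) dec′ top)
         (trans (cong (λ d → souths (q 0) ++ replicate d east) (n∸n≡0 m)) (++-identityʳ _)) ⟨
  rowSteps m (m ∷ ms) q ∎
  where
  open ≡-Reasoning
  easts : List Step
  easts = replicate (m ∸ ms ‼ 0) east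

-- The transposed side walks the boundary forward and the upright side walks it backward, so this is
-- where the symmetry of closed walks is applied.
process-conjugate : ∀ q ns → Linked _≥_ ns →
  process q (length ns) (conjugate ns) (const 1) ε ≡ process (const 1) (ns ‼ 0) ns q ε
process-conjugate q ns dec = begin
  process q (length ns) (conjugate ns) (const 1) ε   ≡⟨ cong-app (run⃗-columnSteps q (length ns) (conjugate ns)) ε ⟨
  run⃗ (columnSteps q (length ns) (conjugate ns)) δ ε ≡⟨ cong (λ ss → run⃗ ss δ ε) (columnSteps≡rowSteps q ns dec) ⟩
  run⃗ (rowSteps (ns ‼ 0) ns q) δ ε                   ≡⟨ run⃗≡run⃖ (rowSteps (ns ‼ 0) ns q) ⟩
  run⃖ (rowSteps (ns ‼ 0) ns q) δ ε                   ≡⟨ cong-app (run⃖-rowSteps (ns ‼ 0) ns q) ε ⟩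
  process (const 1) (ns ‼ 0) ns q ε                  ∎
  where open ≡-Reasoning

length-conjugate : ∀ ns → Linked _≥_ ns → length (conjugate ns) ≡ ns ‼ 0
length-conjugate []       _   = refl
length-conjugate (m ∷ ms) dec with dec′ , top ← linked-tail dec = begin
  length (map suc (conjugate ms) ++ replicate (m ∸ ms ‼ 0) 1)
    ≡⟨ length-++ (map suc (conjugate ms)) ⟩
  length (map suc (conjugate ms)) + length (replicate (m ∸ ms ‼ 0) 1)
    ≡⟨ cong₂ _+_ (trans (length-map suc (conjugate ms)) (length-conjugate ms dec′))
                (length-replicate (m ∸ ms ‼ 0)) ⟩
  ms ‼ 0 + (m ∸ ms ‼ 0)
    ≡⟨ m+[n∸m]≡n top ⟩
  m ∎
  where
  open ≡-Reasoning

‼-padded : ∀ hs d {c} → c < length hs + d → (map suc hs ++ replicate d 1) ‼ c ≡ suc (hs ‼ c)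
‼-padded []       (suc d) {zero}  c<      = refl
‼-padded []       (suc d) {suc c} (s≤s c<) = ‼-padded [] d c<
‼-padded (h ∷ hs) d       {zero}  c<      = refl
‼-padded (h ∷ hs) d       {suc c} (s≤s c<) = ‼-padded hs d c<

‼-inside : ∀ ns {i c} → c < ns ‼ i → i < length ns
‼-inside (n ∷ ns) {zero}  c< = s≤s z≤n
‼-inside (n ∷ ns) {suc i} c< = s≤s (‼-inside ns c<)

‼-antitone : ∀ ns {i j} → Linked _≥_ ns → i ≤ j → ns ‼ j ≤ ns ‼ i
‼-antitone []                         dec i≤j = z≤n
‼-antitone (n ∷ ns) {zero}  {zero}  dec i≤j = ≤-refl
‼-antitone (n ∷ ns) {zero}  {suc j} dec i≤j with dec′ , top ← linked-tail dec =
  ≤-trans (‼-antitone ns dec′ (z≤n {j})) top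
‼-antitone (n ∷ ns) {suc i} {suc j} dec (s≤s i≤j) = ‼-antitone ns (proj₁ (linked-tail dec)) i≤j

conjugate-‼ : ∀ {m ms c} → Linked _≥_ (m ∷ ms) → c < m → conjugate (m ∷ ms) ‼ c ≡ suc (conjugate ms ‼ c)
conjugate-‼ {m} {ms} dec c<m with dec′ , top ← linked-tail dec =
  ‼-padded (conjugate ms) (m ∸ ms ‼ 0)
    (subst (_ <_) (sym (trans (cong (_+ (m ∸ ms ‼ 0)) (length-conjugate ms dec′)) (m+[n∸m]≡n top))) c<m)

conjugate-⁺ : ∀ ns {i c} → Linked _≥_ ns → c < ns ‼ i → i < conjugate ns ‼ c
conjugate-⁺ (m ∷ ms) {zero}  dec c< rewrite conjugate-‼ dec c< = s≤s z≤n
conjugate-⁺ (m ∷ ms) {suc i} {c} dec c<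
  rewrite conjugate-‼ {ms = ms} dec (<-≤-trans c< (‼-antitone (m ∷ ms) {0} {suc i} dec z≤n)) =
  s≤s (conjugate-⁺ ms (proj₁ (linked-tail dec)) c<)

conjugate-⁻ : ∀ ns {i c} → Linked _≥_ ns → i < conjugate ns ‼ c → c < ns ‼ i
conjugate-⁻ (m ∷ ms) {i} {c} dec i<
  with c<m ← subst (c <_) (length-conjugate (m ∷ ms) dec) (‼-inside (conjugate (m ∷ ms)) i<)
  rewrite conjugate-‼ {ms = ms} dec c<m = go i i<
  where
  go : ∀ i → i < suc (conjugate ms ‼ c) → c < (m ∷ ms) ‼ i
  go zero    _         = c<m
  go (suc i) (s≤s i<′) = conjugate-⁻ ms (proj₁ (linked-tail dec)) i<′

conjugate-linked : ∀ ns → Linked _≥_ ns → Linked _≥_ (length ns ∷ conjugate ns)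
conjugate-linked []       _   = [-]
conjugate-linked (m ∷ ms) dec = pad (conjugate ms) (conjugate-linked ms (proj₁ (linked-tail dec)))
  where
  d = m ∸ ms ‼ 0
  flat : ∀ n d → Linked _≥_ (suc n ∷ replicate d 1)
  flat n zero    = [-]
  flat n (suc d) = s≤s z≤n ∷ flat 0 d
  pad : ∀ {n} hs → Linked _≥_ (n ∷ hs) → Linked _≥_ (suc n ∷ map suc hs ++ replicate d 1)
  pad {n} []       _            = flat n d
  pad     (h ∷ hs) (n≥h ∷ dec′) = s≤s n≥h ∷ pad hs dec′

-- Fillings as matrices

cnt : ℕ → (ℕ → Bool) → ℕ
cnt zero    f = 0
cnt (suc n) f = bit (f n) + cnt n f

cnt-cong : ∀ n {f h : ℕ → Bool} → (∀ {k} → k < n → f k ≡ h k) → cnt n f ≡ cnt n h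
cnt-cong zero    eq = refl
cnt-cong (suc n) eq = cong₂ _+_ (cong bit (eq ≤-refl)) (cnt-cong n (eq ∘ m<n⇒m<1+n))

cnt-truncate : ∀ m d {f : ℕ → Bool} → (∀ {k} → m ≤ k → f k ≡ false) → cnt (m + d) f ≡ cnt m f
cnt-truncate m zero    {f} none = cong (λ k → cnt k f) (+-identityʳ m)
cnt-truncate m (suc d)     none rewrite +-suc m d | none (m≤m+n m d) = cnt-truncate m d none

cnt-≤ : ∀ {m n} {f : ℕ → Bool} → m ≤ n → (∀ {k} → m ≤ k → f k ≡ false) → cnt m f ≡ cnt n f
cnt-≤ {m} {n} {f} m≤n none =
  trans (sym (cnt-truncate m (n ∸ m) none)) (cong (λ k → cnt k f) (m+[n∸m]≡n m≤n))

cnt≡sum< : ∀ n f → cnt n f ≡ sum< n (bit ∘ f)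
cnt≡sum< zero    f = refl
cnt≡sum< (suc n) f = trans (cong (bit (f n) +_) (cnt≡sum< n f)) (sym (sum<-last n (bit ∘ f)))

cnt-none : ∀ n {f k} → cnt n f ≡ 0 → k < n → f k ≡ false
cnt-none (suc n) {f} eq k<n with f n in fn | m<1+n⇒m<n∨m≡n k<n
... | false | inj₁ k<n′ = cnt-none n eq k<n′
... | false | inj₂ refl = fn

cnt-unique : ∀ n {f j k} → cnt n f ≡ 1 → j < n → k < n → f j ≡ true → f k ≡ true → j ≡ k
cnt-unique (suc n) {f} eq j<n k<n fj fk with f n in fn | m<1+n⇒m<n∨m≡n j<n | m<1+n⇒m<n∨m≡n k<n
... | false | inj₁ j<n′ | inj₁ k<n′ = cnt-unique n eq j<n′ k<n′ fj fk
... | false | inj₂ refl | _         = clash fj fn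
... | false | _         | inj₂ refl = clash fk fn
... | true  | inj₂ refl | inj₂ refl = refl
... | true  | inj₁ j<n′ | _         = clash fj (cnt-none n (suc-injective eq) j<n′)
... | true  | _         | inj₁ k<n′ = clash fk (cnt-none n (suc-injective eq) k<n′)

length-filter-tabulate : ∀ {A : Set} {P : A → Set} (P? : Decidable P) n (g : Fin n → A) {h : ℕ → Bool} →
  (∀ k → does (P? (g k)) ≡ h (toℕ k)) → length (filter P? (tabulate g)) ≡ sum< n (bit ∘ h)
length-filter-tabulate P? zero    g eq = refl
length-filter-tabulate P? (suc n) g {h} eq with P? (g zero) | eq zero
... | yes _ | e = cong₂ _+_ (cong bit e) (length-filter-tabulate P? n (g ∘ suc) (eq ∘ suc))
... | no  _ | e = cong₂ _+_ (cong bit e) (length-filter-tabulate P? n (g ∘ suc) (eq ∘ suc))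

length-filter-allFin : ∀ n {P : Fin n → Set} (P? : Decidable P) {h : ℕ → Bool} →
  (∀ k → does (P? k) ≡ h (toℕ k)) → length (filter P? (allFin n)) ≡ cnt n h
length-filter-allFin n P? {h} eq = trans (length-filter-tabulate P? n (λ k → k) eq) (sym (cnt≡sum< n h))

isOne : Maybe Bool → Bool
isOne (just b) = b
isOne nothing  = false

does-isOne : ∀ e → does (e ≟ᵉ just true) ≡ isOne e
does-isOne (just true)  = refl
does-isOne (just false) = refl
does-isOne nothing      = refl

-- Positions outside the shape count as zeros, so a filling becomes a matrix on all of ℕ × ℕ and
-- transposition becomes `flip`.
one : ∀ {ns} → Filling ns → ℕ → ℕ → Bool
one F i c = isOne (entry F i c)

cell-inside : ∀ {n} (v : Vec Bool n) {c} → c < n → ∃ λ b → cell v c ≡ just b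
cell-inside (b ∷ v) {zero}  _        = b , refl
cell-inside (b ∷ v) {suc c} (s≤s c<n) = cell-inside v c<n

cell-inside⁻ : ∀ {n} (v : Vec Bool n) {c b} → cell v c ≡ just b → c < n
cell-inside⁻ (b ∷ v) {zero}  eq = s≤s z≤n
cell-inside⁻ (b ∷ v) {suc c} eq = s≤s (cell-inside⁻ v eq)

entry-inside : ∀ {ns} (F : Filling ns) {i c} → c < ns ‼ i → ∃ λ b → entry F i c ≡ just b
entry-inside (v ∷ F) {zero}  c< = cell-inside v c<
entry-inside (v ∷ F) {suc i} c< = entry-inside F c<

entry-inside⁻ : ∀ {ns} (F : Filling ns) {i c b} → entry F i c ≡ just b → c < ns ‼ i
entry-inside⁻ (v ∷ F) {zero}  eq = cell-inside⁻ v eq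
entry-inside⁻ (v ∷ F) {suc i} eq = entry-inside⁻ F eq

one-entry : ∀ {ns} (F : Filling ns) {i c} → one F i c ≡ true → entry F i c ≡ just true
one-entry F {i} {c} eq with entry F i c
one-entry F refl | just true = refl

entry-one : ∀ {ns} (F : Filling ns) {i c b} → entry F i c ≡ just b → one F i c ≡ b
entry-one F eq = cong isOne eq

zero-entry : ∀ {ns} (F : Filling ns) {i c} → c < ns ‼ i → one F i c ≡ false → entry F i c ≡ just false
zero-entry F c< eq with b , e ← entry-inside F c< = trans e (cong just (trans (sym (cong isOne e)) eq))

one-inside : ∀ {ns} (F : Filling ns) {i c} → one F i c ≡ true → c < ns ‼ i
one-inside F = entry-inside⁻ F ∘ one-entry F

one-outside : ∀ {ns} (F : Filling ns) {i c} → ns ‼ i ≤ c → one F i c ≡ false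
one-outside F {i} {c} out with one F i c in eq
... | false = refl
... | true  = contradiction out (<⇒≱ (one-inside F eq))

leftRow : ∀ n → (ℕ → Bool) → Vec Bool n
leftRow zero    f = []
leftRow (suc n) f = f 0 ∷ leftRow n (f ∘ suc)

fill : (ℕ → ℕ → Bool) → ∀ ns → Filling ns
fill X []       = []
fill X (n ∷ ns) = leftRow n (X 0) ∷ fill (X ∘ suc) ns

cell-leftRow : ∀ n f {c} → c < n → cell (leftRow n f) c ≡ just (f c)
cell-leftRow (suc n) f {zero}  _        = refl
cell-leftRow (suc n) f {suc c} (s≤s c<n) = cell-leftRow n (f ∘ suc) c<n

entry-fill : ∀ X ns {i c} → c < ns ‼ i → entry (fill X ns) i c ≡ just (X i c)
entry-fill X (n ∷ ns) {zero}  c< = cell-leftRow n (X 0) c<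
entry-fill X (n ∷ ns) {suc i} c< = entry-fill (X ∘ suc) ns c<

leftRow-cell : ∀ {n} (v : Vec Bool n) {f} → (∀ {c} → c < n → f c ≡ isOne (cell v c)) → leftRow n f ≡ v
leftRow-cell []      eq = refl
leftRow-cell (b ∷ v) eq = cong₂ _∷_ (eq (s≤s z≤n)) (leftRow-cell v (eq ∘ s≤s))

fill-one : ∀ {ns} (F : Filling ns) {X} → (∀ i {c} → c < ns ‼ i → X i c ≡ one F i c) → fill X ns ≡ F
fill-one []      eq = refl
fill-one (v ∷ F) eq = cong₂ _∷_ (leftRow-cell v (eq 0)) (fill-one F (eq ∘ suc))

-- Here the head of a row of n + 1 bits is the bit of column n.
rightCell : ∀ {n} → Vec Bool n → ℕ → Bool
rightCell         []      c = false
rightCell {suc n} (b ∷ v) c = if c ≡ᵇ n then b else rightCell v c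

bits : ∀ {ms} → Filling ms → ℕ → ℕ → Bool
bits []      i       c = false
bits (v ∷ G) zero    c = rightCell v c
bits (v ∷ G) (suc i) c = bits G i c

rightRow : ∀ n → (ℕ → Bool) → Vec Bool n
rightRow zero    f = []
rightRow (suc n) f = f n ∷ rightRow n f

fillRight : (ℕ → ℕ → Bool) → ∀ ms → Filling ms
fillRight X []       = []
fillRight X (m ∷ ms) = rightRow m (X 0) ∷ fillRight (X ∘ suc) ms

<⇒≢ᵇ : ∀ {m n} → m < n → (m ≡ᵇ n) ≡ false
<⇒≢ᵇ {zero}  {suc n} _        = refl
<⇒≢ᵇ {suc m} {suc n} (s≤s m<n) = <⇒≢ᵇ m<n

rightCell-head : ∀ {n} b (v : Vec Bool n) → rightCell (b ∷ v) n ≡ b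
rightCell-head {n} b v rewrite ≡ᵇ-refl n = refl

rightCell-tail : ∀ {n} b (v : Vec Bool n) {c} → c < n → rightCell (b ∷ v) c ≡ rightCell v c
rightCell-tail b v c<n rewrite <⇒≢ᵇ c<n = refl

rightCell-outside : ∀ {n} (v : Vec Bool n) {c} → n ≤ c → rightCell v c ≡ false
rightCell-outside         []      _ = refl
rightCell-outside {suc n} (b ∷ v) {c} n<c with c ≡ᵇ n in eq
... | false = rightCell-outside v (<⇒≤ n<c)
... | true  = contradiction (sym (≡ᵇ-sound c n eq)) (<⇒≢ n<c)

rightCell-rightRow : ∀ n f {c} → c < n → rightCell (rightRow n f) c ≡ f c
rightCell-rightRow (suc n) f c<n with m<1+n⇒m<n∨m≡n c<n
... | inj₁ c<n′ = trans (rightCell-tail (f n) (rightRow n f) c<n′) (rightCell-rightRow n f c<n′)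
... | inj₂ refl = rightCell-head (f n) (rightRow n f)

rightRow-rightCell : ∀ {n} (v : Vec Bool n) {f} → (∀ {c} → c < n → f c ≡ rightCell v c) → rightRow n f ≡ v
rightRow-rightCell []      eq = refl
rightRow-rightCell (b ∷ v) eq = cong₂ _∷_ (trans (eq ≤-refl) (rightCell-head b v))
  (rightRow-rightCell v (λ c<n → trans (eq (m<n⇒m<1+n c<n)) (rightCell-tail b v c<n)))

bits-fillRight : ∀ X ms {i c} → c < ms ‼ i → bits (fillRight X ms) i c ≡ X i c
bits-fillRight X (m ∷ ms) {zero}  c< = rightCell-rightRow m (X 0) c<
bits-fillRight X (m ∷ ms) {suc i} c< = bits-fillRight (X ∘ suc) ms c<

fillRight-bits : ∀ {ms} (G : Filling ms) {X} → (∀ i {c} → c < ms ‼ i → X i c ≡ bits G i c) → fillRight X ms ≡ G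
fillRight-bits []      eq = refl
fillRight-bits (v ∷ G) eq = cong₂ _∷_ (rightRow-rightCell v (eq 0)) (fillRight-bits G (eq ∘ suc))

bits-outside : ∀ {ms} (G : Filling ms) {i c} → ms ‼ i ≤ c → bits G i c ≡ false
bits-outside []              out = refl
bits-outside (v ∷ G) {zero}  out = rightCell-outside v out
bits-outside (v ∷ G) {suc i} out = bits-outside G out

module MatrixProperties (X : ℕ → ℕ → Bool) where
  open Matrix X

  count≡cnt : ∀ i c → count i c ≡ cnt i (λ j → X j c)
  count≡cnt zero    c = refl
  count≡cnt (suc i) c = cong (bit (X i c) +_) (count≡cnt i c)

  row≡rightRow : ∀ i n → row i n ≡ rightRow n (X i)
  row≡rightRow i zero    = refl
  row≡rightRow i (suc n) = cong (X i n ∷_) (row≡rightRow i n)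

  weight-row : ∀ i n → weight (row i n) ≡ cnt n (X i)
  weight-row i zero    = refl
  weight-row i (suc n) = cong (bit (X i n) +_) (weight-row i n)

  state-blanks : ∀ n → state 0 n ≡ blanks n
  state-blanks zero    = refl
  state-blanks (suc n) = cong (blank ∷_) (state-blanks n)

  rows-bits : ∀ q i {ms} (G : Filling ms) → (∀ j {c} → c < ms ‼ j → X (i + j) c ≡ bits G j c) → Rows q i G
  rows-bits q i []      eq = tt
  rows-bits q i (_∷_ {x = m} v G) eq =
    sym (trans (row≡rightRow i m) (rightRow-rightCell v
      (λ {c} c<m → trans (cong (λ k → X k c) (sym (+-identityʳ i))) (eq 0 c<m)))) ,
    rows-bits q (suc i) G (λ j {c} c<m → trans (cong (λ k → X k c) (sym (+-suc i j))) (eq (suc j) c<m))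

  present-sound : ∀ i {a} → present i a ≡ true → ∃ λ j → j < i × X j a ≡ true
  present-sound (suc i) {a} eq with ∨-true⁻ {X i a} eq
  ... | inj₁ now = i , ≤-refl , now
  ... | inj₂ old with j , j<i , Xj ← present-sound i old = j , m<n⇒m<1+n j<i , Xj

  present-complete : ∀ i {a j} → j < i → X j a ≡ true → present i a ≡ true
  present-complete (suc i) {a} j<i Xj with m<1+n⇒m<n∨m≡n j<i
  ... | inj₁ j<i′ = ∨-trueʳ (X i a) (present-complete i j<i′ Xj)
  ... | inj₂ refl = ∨-trueˡ (present i a) Xj

  bad-sound : ∀ i {a b} → bad i a b ≡ true →
    ∃₂ λ j k → j ≤ k × k < i × X j a ≡ true × X k b ≡ true
  bad-sound (suc i) {a} {b} eq with ∨-true⁻ {bad i a b} eq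
  ... | inj₁ old with j , k , j≤k , k<i , Xj , Xk ← bad-sound i old = j , k , j≤k , m<n⇒m<1+n k<i , Xj , Xk
  ... | inj₂ new with Xi , pa ← ∧-true⁻ {X i b} new with j , s≤s j≤i , Xj ← present-sound (suc i) pa =
    j , i , j≤i , ≤-refl , Xj , Xi

  bad-complete : ∀ i {a b j k} → j ≤ k → k < i → X j a ≡ true → X k b ≡ true → bad i a b ≡ true
  bad-complete (suc i) {a} {b} j≤k k<i Xj Xk with m<1+n⇒m<n∨m≡n k<i
  ... | inj₁ k<i′ = ∨-trueˡ _ (bad-complete i j≤k k<i′ Xj Xk)
  ... | inj₂ refl = ∨-trueʳ (bad i a b) (∧-true⁺ Xk (present-complete (suc i) (s≤s j≤k) Xj))

  -- Here columns are summed at the end, while `Accepted` sums each one when it is retired. This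
  -- form can be compared with `InW`.
  record Good (q : ℕ → ℕ) (i n : ℕ) (ms : List ℕ) (p : ℕ → ℕ) : Set where
    field
      rowSum    : ∀ j → j < length ms → weight (row (i + j) (ms ‼ j)) ≡ p j
      columnSum : ∀ {c} → c < n → count (i + length ms) c ≡ q c
      avoiding  : ∀ j → j < length ms → RowAvoids (i + j) (ms ‼ j)

  Outside : ℕ → List ℕ → Set
  Outside i ms = ∀ j {c} → ms ‼ j ≤ c → X (i + j) c ≡ false

  outside-tail : ∀ {i m ms} → Outside i (m ∷ ms) → Outside (suc i) ms
  outside-tail {i} out j {c} above = trans (cong (λ k → X k c) (sym (+-suc i j))) (out (suc j) above)

  count-stable : ∀ i k {c} → (∀ j → j < k → X (i + j) c ≡ false) → count (i + k) c ≡ count i c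
  count-stable i zero    {c} none = cong (λ k → count k c) (+-identityʳ i)
  count-stable i (suc k) {c} none rewrite +-suc i k | none k ≤-refl =
    count-stable i k (λ j j<k → none j (m<n⇒m<1+n j<k))

  -- The rows only get shorter, so a retired column already has its final sum.
  count-above : ∀ {i m ms c} → Linked _≥_ (m ∷ ms) → Outside i (m ∷ ms) → m ≤ c →
    count (i + length (m ∷ ms)) c ≡ count i c
  count-above {i} {m} {ms} dec out m≤c =
    count-stable i (length (m ∷ ms)) (λ j _ → out j (≤-trans (‼-antitone (m ∷ ms) {0} {j} dec z≤n) m≤c))

  open Good

  good : ∀ q i n ms p → Linked _≥_ (n ∷ ms) → Outside i ms → Accepted q i n ms p → Good q i n ms p
  good q i n [] p _ _ acc .rowSum j ()
  good q i n [] p _ _ acc .columnSum {c} c<n = trans (cong (λ k → count k c) (+-identityʳ i)) (acc c<n)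
  good q i n [] p _ _ acc .avoiding j ()
  good q i n (m ∷ ms) p (m≤n ∷ dec) out (fit , w , av , acc) = record
    { rowSum    = λ { zero _ → subst (λ k → weight (row k m) ≡ p 0) (sym (+-identityʳ i)) w
                    ; (suc j) (s≤s j<) → subst (λ k → weight (row k (ms ‼ j)) ≡ p (suc j)) (sym (+-suc i j)) (rowSum rest j j<) }
    ; columnSum = λ {c} c<n → column c<n
    ; avoiding  = λ { zero _ → subst (λ k → RowAvoids k m) (sym (+-identityʳ i)) av
                    ; (suc j) (s≤s j<) → subst (λ k → RowAvoids k (ms ‼ j)) (sym (+-suc i j)) (avoiding rest j j<) }
    }
    where
    rest : Good q (suc i) m ms (p ∘ suc)
    rest = good q (suc i) m ms (p ∘ suc) dec (outside-tail out) acc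
    column : ∀ {c} → c < n → count (i + suc (length ms)) c ≡ q c
    column {c} c<n with c <? m
    ... | yes c<m = trans (cong (λ k → count k c) (+-suc i (length ms))) (columnSum rest c<m)
    ... | no  c≮m = trans (count-above dec out (≮⇒≥ c≮m)) (fit (≮⇒≥ c≮m) c<n)

  accepted : ∀ q i n ms p → Linked _≥_ (n ∷ ms) → Outside i ms → Good q i n ms p → Accepted q i n ms p
  accepted q i n [] p _ _ g {c} c<n = trans (cong (λ k → count k c) (sym (+-identityʳ i))) (columnSum g c<n)
  accepted q i n (m ∷ ms) p (m≤n ∷ dec) out g =
    (λ m≤c c<n → trans (sym (count-above dec out m≤c)) (columnSum g c<n)) ,
    subst (λ k → weight (row k m) ≡ p 0) (+-identityʳ i) (rowSum g 0 (s≤s z≤n)) ,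
    subst (λ k → RowAvoids k m) (+-identityʳ i) (λ {a} {b} {c} → avoiding g 0 (s≤s z≤n) {a} {b} {c}) ,
    accepted q (suc i) m ms (p ∘ suc) dec (outside-tail out) (record
      { rowSum    = λ j j< → subst (λ k → weight (row k (ms ‼ j)) ≡ p (suc j)) (+-suc i j) (rowSum g (suc j) (s≤s j<))
      ; columnSum = λ {c} c<m → trans (cong (λ k → count k c) (sym (+-suc i (length ms)))) (columnSum g (<-≤-trans c<m m≤n))
      ; avoiding  = λ j j< → subst (λ k → RowAvoids k (ms ‼ j)) (+-suc i j) (avoiding g (suc j) (s≤s j<)) })

-- The two pattern sets

open MatrixProperties using (Good; good; accepted; rows-bits; state-blanks; weight-row; count≡cnt;
  bad-sound; bad-complete)
open Good

twist : Bool → (ℕ → ℕ → Bool) → ℕ → ℕ → Bool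
twist false X = X
twist true  X = flip X

twist-swap : ∀ t {X Y : ℕ → ℕ → Bool} → (∀ i c → X i c ≡ twist t Y i c) → ∀ i c → twist t X i c ≡ Y i c
twist-swap false eq i c = eq i c
twist-swap true  eq i c = eq c i

module Transfer (ns ms : List ℕ) (t : Bool)
  (there-bits : ∀ (F : Filling ns) i c → bits (fillRight (twist t (one F)) ms) i c ≡ twist t (one F) i c)
  (back-one   : ∀ (G : Filling ms) i c → one (fill (twist t (bits G)) ns) i c ≡ twist t (bits G) i c)
  (q : ℕ → ℕ) (n : ℕ) (p : ℕ → ℕ) (desc : Linked _≥_ (n ∷ ms))
  {P : Filling ns → Set} (P? : Decidable P)
  (P⇒Good : ∀ F → P F → Good (twist t (one F)) q 0 n ms p)
  -- The matrix is given up to pointwise equality, because the way back knows it as `bits G`.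
  (Good⇒P : ∀ F X → (∀ i c → X i c ≡ twist t (one F) i c) → Good X q 0 n ms p → P F)
  where

  there : Filling ns → Filling ms
  there F = fillRight (twist t (one F)) ms

  back : Filling ms → Filling ns
  back G = fill (twist t (bits G)) ns

  ok : Filling ms → Bool
  ok = accepts q n (blanks n) p

  there-ok : ∀ {F} → P F → ok (there F) ≡ true
  there-ok {F} PF = subst (λ s → accepts q n s p (there F) ≡ true) (state-blanks X n)
    (Matrix.accepts-complete X q 0 n p (there F) desc
      (rows-bits X q 0 (there F) (λ j {c} _ → sym (there-bits F j c)))
      (accepted X q 0 n ms p desc outside (P⇒Good F PF)))
    where
    X : ℕ → ℕ → Bool
    X = twist t (one F)
    outside : ∀ j {c} → ms ‼ j ≤ c → X j c ≡ false
    outside j {c} out = trans (sym (there-bits F j c)) (bits-outside (there F) out)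

  back-P : ∀ {G} → ok G ≡ true → P (back G)
  back-P {G} okG = Good⇒P (back G) (bits G) (λ i c → sym (twist-swap t (back-one G) i c))
    (good (bits G) q 0 n ms p desc (λ j → bits-outside G)
      (Matrix.accepts-sound (bits G) q 0 n p G desc (rows-bits (bits G) q 0 G (λ _ _ → refl))
        (subst (λ s → accepts q n s p G ≡ true) (sym (state-blanks (bits G) n)) okG)))

  back-there : ∀ F → back (there F) ≡ F
  back-there F = fill-one F (λ i {c} _ → twist-swap t (there-bits F) i c)

  there-back : ∀ G → there (back G) ≡ G
  there-back G = fillRight-bits G (λ i {c} _ → twist-swap t (back-one G) i c)

  count-process : length (filter P? (fillings ns)) ≡ process q n ms p ε
  count-process = begin
    length (filter P? (fillings ns))
      ≡⟨ ≤-antisym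
           (filter-≤ P? ok? (fillings-unique ns) fillings-complete there back there-ok (λ _ → back-there _))
           (filter-≤ ok? P? (fillings-unique ms) fillings-complete back there (λ {G} → back-P {G}) (λ _ → there-back _)) ⟩
    length (filter ok? (fillings ms))          ≡⟨ total-filter ok (fillings ms) ⟨
    total (fillings ms) (λ G → gate (ok G) 1)  ≡⟨ accepts-total q n ms p (blanks n) (length-replicate n) desc ⟩
    processᶜ q n ms p (blanks n)               ≡⟨ processᶜ-blanks q n ms p desc ⟩
    process q n ms p ε                         ∎
    where
    open ≡-Reasoning
    ok? : Decidable (λ G → ok G ≡ true)
    ok? G = ok G Bool.≟ true

-- Pattern containment as triples of ones

allPairs-lookup : ∀ {A : Set} {R : A → A → Set} {n} {v : Vec A n} → AllPairs R v →
  ∀ {k l} → k Fin.< l → R (Vec.lookup v k) (Vec.lookup v l)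
allPairs-lookup (r ∷ rs) {zero}  {suc l} _         = VecAll.lookup⁺ r l
allPairs-lookup (r ∷ rs) {suc k} {suc l} (s≤s k<l) = allPairs-lookup rs k<l

increasing-injective : ∀ {m n} {v : Vec (Fin m) n} → AllPairs Fin._<_ v →
  ∀ {k l} → toℕ (Vec.lookup v k) ≡ toℕ (Vec.lookup v l) → k ≡ l
increasing-injective inc {k} {l} eq with Fin.<-cmp k l
... | tri< k<l _ _ = contradiction eq (<⇒≢ (allPairs-lookup inc k<l))
... | tri≈ _ k≡l _ = k≡l
... | tri> _ _ l<k = contradiction (sym eq) (<⇒≢ (allPairs-lookup inc l<k))

toFin : ∀ {k n} → k < n → ∃ λ (r : Fin n) → toℕ r ≡ k
toFin k<n = fromℕ< k<n , Fin.toℕ-fromℕ< k<n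

module _ (Λ : FerrersShape) (F : Filling (rows Λ)) where

  private
    ns = rows Λ
    H  = height Λ
    W  = width Λ

  onesInRow≡cnt : ∀ i → onesInRow Λ F i ≡ cnt W (one F i)
  onesInRow≡cnt i = length-filter-allFin W _ (λ c → does-isOne (entry F i (toℕ c)))

  onesInColumn≡cnt : ∀ c → onesInColumn Λ F c ≡ cnt H (λ i → one F i c)
  onesInColumn≡cnt c = length-filter-allFin H _ (λ i → does-isOne (entry F (toℕ i) c))

  one-row : ∀ {i c} → one F i c ≡ true → i < H
  one-row = ‼-inside ns ∘ one-inside F

  one-column : ∀ {i c} → one F i c ≡ true → c < W
  one-column {i} 1ic = <-≤-trans (one-inside F 1ic) (‼-antitone ns {0} {i} (decreasing Λ) z≤n)

  OneInColumns : Set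
  OneInColumns = ∀ {i j c} → one F i c ≡ true → one F j c ≡ true → i ≡ j

  oneInColumns : (∀ {c} → c < W → cnt H (λ i → one F i c) ≡ 1) → OneInColumns
  oneInColumns single 1ic 1jc = cnt-unique H (single (one-column 1ic)) (one-row 1ic) (one-row 1jc) 1ic 1jc

  -- It suffices to exhibit the ones: each chosen column has no other, which supplies the zeros, and
  -- one cell of the shape weakly above and right of all choices puts every cell inside. The vector
  -- `letter` lists the letters counted from zero, as confirmed by evaluation.
  contains : OneInColumns → ∀ x {ρ : Vec (Fin H) (largest x)} {γ : Vec (Fin W) (Word.size x)} →
    AllPairs Fin._<_ ρ → AllPairs Fin._<_ γ → (letter : Vec (Fin (largest x)) (Word.size x)) →
    {True (Fin.all? λ l → Fin.all? λ j → M x l j Bool.≟ does (l Fin.≟ Vec.lookup letter j))} →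
    (∀ j → one F (toℕ (Vec.lookup ρ (Vec.lookup letter j))) (toℕ (Vec.lookup γ j)) ≡ true) →
    ∀ top right → right < ns ‼ top →
    (∀ l → toℕ (Vec.lookup ρ l) ≤ top) → (∀ j → toℕ (Vec.lookup γ j) ≤ right) →
    Contains Λ F x
  contains single x {ρ} {γ} incρ incγ letter {check} hits top right inside ρ≤ γ≤ =
    ρ , γ , incρ , incγ , λ l j → trans (entries l j) (cong just (sym (toWitness check l j)))
    where
    entries : ∀ l j → entry F (toℕ (Vec.lookup ρ l)) (toℕ (Vec.lookup γ j)) ≡ just (does (l Fin.≟ Vec.lookup letter j))
    entries l j with l Fin.≟ Vec.lookup letter j
    ... | yes refl = one-entry F (hits j)
    ... | no  l≢   = zero-entry F
      (<-≤-trans (≤-<-trans (γ≤ j) inside) (‼-antitone ns (decreasing Λ) (ρ≤ l))) miss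
      where
      miss : one F (toℕ (Vec.lookup ρ l)) (toℕ (Vec.lookup γ j)) ≡ false
      miss with one F (toℕ (Vec.lookup ρ l)) (toℕ (Vec.lookup γ j)) in eq
      ... | false = refl
      ... | true  = contradiction (increasing-injective incρ (single eq (hits j))) l≢

  -- The second is the first for the transposed filling: there `i`, `j`, `k` are columns and `a`,
  -- `b`, `c` are rows.
  Avoids312-211 Avoids231-121 : Set
  Avoids312-211 = ∀ {i j k a b c} → j ≤ k → k < i → a ≤ b → b < c → c < ns ‼ i →
    one F i a ≡ true → one F j b ≡ true → one F k c ≡ true → ⊥
  Avoids231-121 = ∀ {i j k a b c} → j ≤ k → k < i → a ≤ b → b < c → i < ns ‼ c →
    one F a i ≡ true → one F b j ≡ true → one F c k ≡ true → ⊥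

  -- Equality of `a` and `b` would put ones in rows `j < i` of one column. Otherwise `j < k` gives
  -- 312 and `j ≡ k` gives 211.
  avoids312-211 : OneInColumns → All (Avoids Λ F) (w312 ∷ w211 ∷ []) → Avoids312-211
  avoids312-211 single (no312 ∷ no211 ∷ []) {i} {j} {k} {a} {b} {c} j≤k k<i a≤b b<c inside ia jb kc
    with i′ , refl ← toFin (one-row ia) with j′ , refl ← toFin (one-row jb) with k′ , refl ← toFin (one-row kc)
    with a′ , refl ← toFin (one-column ia) with b′ , refl ← toFin (one-column jb) with c′ , refl ← toFin (one-column kc)
    with m≤n⇒m<n∨m≡n a≤b | m≤n⇒m<n∨m≡n j≤k
  ... | inj₂ a≡b | _ = <⇒≢ (≤-<-trans j≤k k<i) (single (subst (λ x → one F j x ≡ true) (sym a≡b) jb) ia)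
  ... | inj₁ a<b | inj₁ j<k = no312 (contains single w312 {j′ ∷ k′ ∷ i′ ∷ []} {a′ ∷ b′ ∷ c′ ∷ []}
    ((j<k ∷ <-trans j<k k<i ∷ []) ∷ (k<i ∷ []) ∷ [] ∷ [])
    ((a<b ∷ <-trans a<b b<c ∷ []) ∷ (b<c ∷ []) ∷ [] ∷ [])
    (2F ∷ 0F ∷ 1F ∷ []) (λ { 0F → ia ; 1F → jb ; 2F → kc }) i c inside
    (λ { 0F → <⇒≤ (<-trans j<k k<i) ; 1F → <⇒≤ k<i ; 2F → ≤-refl })
    (λ { 0F → <⇒≤ (<-trans a<b b<c) ; 1F → <⇒≤ b<c ; 2F → ≤-refl }))
  ... | inj₁ a<b | inj₂ j≡k = no211 (contains single w211 {j′ ∷ i′ ∷ []} {a′ ∷ b′ ∷ c′ ∷ []}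
    ((j<i ∷ []) ∷ [] ∷ [])
    ((a<b ∷ <-trans a<b b<c ∷ []) ∷ (b<c ∷ []) ∷ [] ∷ [])
    (1F ∷ 0F ∷ 0F ∷ []) (λ { 0F → ia ; 1F → jb ; 2F → subst (λ x → one F x c ≡ true) (sym j≡k) kc }) i c inside
    (λ { 0F → <⇒≤ j<i ; 1F → ≤-refl })
    (λ { 0F → <⇒≤ (<-trans a<b b<c) ; 1F → <⇒≤ b<c ; 2F → ≤-refl }))
    where
    j<i : j < i
    j<i = ≤-<-trans j≤k k<i

  avoids312-211⁻ : Avoids312-211 → All (Avoids Λ F) (w312 ∷ w211 ∷ [])
  avoids312-211⁻ av =
    (λ { (ρ , γ , incρ , incγ , eq) → av
      (<⇒≤ (allPairs-lookup incρ {0F} {1F} (s≤s z≤n))) (allPairs-lookup incρ {1F} {2F} (s≤s (s≤s z≤n)))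
      (<⇒≤ (allPairs-lookup incγ {0F} {1F} (s≤s z≤n))) (allPairs-lookup incγ {1F} {2F} (s≤s (s≤s z≤n)))
      (entry-inside⁻ F (eq 2F 2F)) (entry-one F (eq 2F 0F)) (entry-one F (eq 0F 1F)) (entry-one F (eq 1F 2F)) }) ∷
    (λ { (ρ , γ , incρ , incγ , eq) → av
      ≤-refl (allPairs-lookup incρ {0F} {1F} (s≤s z≤n))
      (<⇒≤ (allPairs-lookup incγ {0F} {1F} (s≤s z≤n))) (allPairs-lookup incγ {1F} {2F} (s≤s (s≤s z≤n)))
      (entry-inside⁻ F (eq 1F 2F)) (entry-one F (eq 1F 0F)) (entry-one F (eq 0F 1F)) (entry-one F (eq 0F 2F)) }) ∷
    []

  -- After transposition it is `j ≡ k` that would put two ones in a column, in rows `b < c`.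
  -- Otherwise `a < b` gives 231 and `a ≡ b` gives 121.
  avoids231-121 : OneInColumns → All (Avoids Λ F) (w231 ∷ w121 ∷ []) → Avoids231-121
  avoids231-121 single (no231 ∷ no121 ∷ []) {i} {j} {k} {a} {b} {c} j≤k k<i a≤b b<c inside ai bj ck
    with i′ , refl ← toFin (one-column ai) with j′ , refl ← toFin (one-column bj) with k′ , refl ← toFin (one-column ck)
    with a′ , refl ← toFin (one-row ai) with b′ , refl ← toFin (one-row bj) with c′ , refl ← toFin (one-row ck)
    with m≤n⇒m<n∨m≡n j≤k | m≤n⇒m<n∨m≡n a≤b
  ... | inj₂ j≡k | _ = <⇒≢ b<c (single (subst (λ x → one F b x ≡ true) j≡k bj) ck)
  ... | inj₁ j<k | inj₁ a<b = no231 (contains single w231 {a′ ∷ b′ ∷ c′ ∷ []} {j′ ∷ k′ ∷ i′ ∷ []}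
    ((a<b ∷ <-trans a<b b<c ∷ []) ∷ (b<c ∷ []) ∷ [] ∷ [])
    ((j<k ∷ <-trans j<k k<i ∷ []) ∷ (k<i ∷ []) ∷ [] ∷ [])
    (1F ∷ 2F ∷ 0F ∷ []) (λ { 0F → bj ; 1F → ck ; 2F → ai }) c i inside
    (λ { 0F → <⇒≤ (<-trans a<b b<c) ; 1F → <⇒≤ b<c ; 2F → ≤-refl })
    (λ { 0F → <⇒≤ (<-trans j<k k<i) ; 1F → <⇒≤ k<i ; 2F → ≤-refl }))
  ... | inj₁ j<k | inj₂ a≡b = no121 (contains single w121 {a′ ∷ c′ ∷ []} {j′ ∷ k′ ∷ i′ ∷ []}
    ((a<c ∷ []) ∷ [] ∷ [])
    ((j<k ∷ <-trans j<k k<i ∷ []) ∷ (k<i ∷ []) ∷ [] ∷ [])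
    (0F ∷ 1F ∷ 0F ∷ []) (λ { 0F → subst (λ x → one F x j ≡ true) (sym a≡b) bj ; 1F → ck ; 2F → ai }) c i inside
    (λ { 0F → <⇒≤ a<c ; 1F → ≤-refl })
    (λ { 0F → <⇒≤ (<-trans j<k k<i) ; 1F → <⇒≤ k<i ; 2F → ≤-refl }))
    where
    a<c : a < c
    a<c = ≤-<-trans a≤b b<c

  avoids231-121⁻ : Avoids231-121 → All (Avoids Λ F) (w231 ∷ w121 ∷ [])
  avoids231-121⁻ av =
    (λ { (ρ , γ , incρ , incγ , eq) → av
      (<⇒≤ (allPairs-lookup incγ {0F} {1F} (s≤s z≤n))) (allPairs-lookup incγ {1F} {2F} (s≤s (s≤s z≤n)))
      (<⇒≤ (allPairs-lookup incρ {0F} {1F} (s≤s z≤n))) (allPairs-lookup incρ {1F} {2F} (s≤s (s≤s z≤n)))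
      (entry-inside⁻ F (eq 2F 2F)) (entry-one F (eq 0F 2F)) (entry-one F (eq 1F 0F)) (entry-one F (eq 2F 1F)) }) ∷
    (λ { (ρ , γ , incρ , incγ , eq) → av
      (<⇒≤ (allPairs-lookup incγ {0F} {1F} (s≤s z≤n))) (allPairs-lookup incγ {1F} {2F} (s≤s (s≤s z≤n)))
      ≤-refl (allPairs-lookup incρ {0F} {1F} (s≤s z≤n))
      (entry-inside⁻ F (eq 1F 2F)) (entry-one F (eq 0F 2F)) (entry-one F (eq 0F 0F)) (entry-one F (eq 1F 1F)) }) ∷
    []

module _ (Λ : FerrersShape) (a : List ℕ) (short : length a ≤ height Λ) where

  private
    ns = rows Λ
    H  = height Λ
    W  = width Λ
    hs = conjugate ns

  -- The walks see only the rows of the shape; above them both sides are zero because `a` is no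
  -- longer than the height.
  content-cnt : ∀ F → (∀ {i} → i < H → cnt W (one F i) ≡ a ‼ i) → ∀ i → onesInRow Λ F i ≡ a ‼ i
  content-cnt F sums i with i <? H
  ... | yes i<H = trans (onesInRow≡cnt Λ F i) (sums i<H)
  ... | no  i≮H = trans (onesInRow-beyond Λ F (≮⇒≥ i≮H)) (sym (‼-beyond a (≤-trans short (≮⇒≥ i≮H))))

  columns-cnt : ∀ {Ω F} → InW Λ a Ω F → ∀ {c} → c < W → cnt H (λ i → one F i c) ≡ 1
  columns-cnt {F = F} w {c} c<W with c′ , refl ← toFin c<W =
    trans (sym (onesInColumn≡cnt Λ F (toℕ c′))) (InW.columns w c′)

  row-beyond : ∀ (F : Filling ns) i {c} → ns ‼ i ≤ c → one F i c ≡ false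
  row-beyond F i = one-outside F

  column-beyond : ∀ (F : Filling ns) c {i} → hs ‼ c ≤ i → one F i c ≡ false
  column-beyond F c {i} out with one F i c in eq
  ... | false = refl
  ... | true  = contradiction out (<⇒≱ (conjugate-⁺ ns (decreasing Λ) (one-inside F eq)))

  hs≤H : ∀ c → hs ‼ c ≤ H
  hs≤H c with hs ‼ c in eq
  ... | zero  = z≤n
  ... | suc h = ‼-inside ns (conjugate-⁻ ns {h} {c} (decreasing Λ) (subst (h <_) (sym eq) ≤-refl))

  module _ (F : Filling ns) (X : ℕ → ℕ → Bool) (X≡ : ∀ i c → X i c ≡ one F i c) where

    upright-row : ∀ i → weight (Matrix.row X i (ns ‼ i)) ≡ cnt W (one F i)
    upright-row i = trans (weight-row X i (ns ‼ i)) (trans (cnt-cong (ns ‼ i) (λ {c} _ → X≡ i c))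
      (cnt-≤ (‼-antitone ns {0} {i} (decreasing Λ) z≤n) (row-beyond F i)))

    upright-column : ∀ c → Matrix.count X H c ≡ cnt H (λ i → one F i c)
    upright-column c = trans (count≡cnt X H c) (cnt-cong H (λ {i} _ → X≡ i c))

    InW⇒upright : InW Λ a (w312 ∷ w211 ∷ []) F → Good X (const 1) 0 W ns (a ‼_)
    InW⇒upright w = record
      { rowSum    = λ i _ → trans (upright-row i) (trans (sym (onesInRow≡cnt Λ F i)) (InW.content w i))
      ; columnSum = λ {c} c<W → trans (upright-column c) (columns-cnt w c<W)
      ; avoiding  = avoid
      }
      where
      avoid : ∀ i → i < H → Matrix.RowAvoids X i (ns ‼ i)
      avoid i _ {x} {y} {z} x≤y y<z z< Xix with Matrix.bad X i y z in eq
      ... | false = refl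
      ... | true with j , k , j≤k , k<i , Xjy , Xkz ← bad-sound X i eq =
        ⊥-elim (avoids312-211 Λ F (oneInColumns Λ F (columns-cnt w)) (InW.avoids w) j≤k k<i x≤y y<z z<
          (trans (sym (X≡ i x)) Xix) (trans (sym (X≡ j y)) Xjy) (trans (sym (X≡ k z)) Xkz))

    upright⇒InW : Good X (const 1) 0 W ns (a ‼_) → InW Λ a (w312 ∷ w211 ∷ []) F
    upright⇒InW g = inW
      (λ c → trans (onesInColumn≡cnt Λ F (toℕ c)) (trans (sym (upright-column (toℕ c))) (columnSum g (Fin.toℕ<n c))))
      (content-cnt F (λ {i} i<H → trans (sym (upright-row i)) (rowSum g i i<H)))
      (avoids312-211⁻ Λ F λ {i} {j} {k} {x} {y} {z} j≤k k<i x≤y y<z z< ix jy kz →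
        clash (bad-complete X i j≤k k<i (trans (X≡ j y) jy) (trans (X≡ k z) kz))
              (avoiding g i (one-row Λ F ix) x≤y y<z z< (trans (X≡ i x) ix)))

  module _ (F : Filling ns) (X : ℕ → ℕ → Bool) (X≡ : ∀ i c → X i c ≡ one F c i) where

    flipped-row : ∀ i → weight (Matrix.row X i (hs ‼ i)) ≡ cnt H (λ c → one F c i)
    flipped-row i = trans (weight-row X i (hs ‼ i)) (trans (cnt-cong (hs ‼ i) (λ {c} _ → X≡ i c))
      (cnt-≤ (hs≤H i) (column-beyond F i)))

    flipped-column : ∀ c → Matrix.count X (length hs) c ≡ cnt W (one F c)
    flipped-column c rewrite length-conjugate ns (decreasing Λ) =
      trans (count≡cnt X W c) (cnt-cong W (λ {i} _ → X≡ i c))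

    InW⇒flipped : InW Λ a (w231 ∷ w121 ∷ []) F → Good X (a ‼_) 0 H hs (const 1)
    InW⇒flipped w = record
      { rowSum    = λ i i< → trans (flipped-row i) (columns-cnt w (subst (i <_) (length-conjugate ns (decreasing Λ)) i<))
      ; columnSum = λ {c} _ → trans (flipped-column c) (trans (sym (onesInRow≡cnt Λ F c)) (InW.content w c))
      ; avoiding  = avoid
      }
      where
      avoid : ∀ i → i < length hs → Matrix.RowAvoids X i (hs ‼ i)
      avoid i _ {x} {y} {z} x≤y y<z z< Xix with Matrix.bad X i y z in eq
      ... | false = refl
      ... | true with j , k , j≤k , k<i , Xjy , Xkz ← bad-sound X i eq =
        ⊥-elim (avoids231-121 Λ F (oneInColumns Λ F (columns-cnt w)) (InW.avoids w) j≤k k<i x≤y y<z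
          (conjugate-⁻ ns (decreasing Λ) z<)
          (trans (sym (X≡ i x)) Xix) (trans (sym (X≡ j y)) Xjy) (trans (sym (X≡ k z)) Xkz))

    flipped⇒InW : Good X (a ‼_) 0 H hs (const 1) → InW Λ a (w231 ∷ w121 ∷ []) F
    flipped⇒InW g = inW
      (λ c → trans (onesInColumn≡cnt Λ F (toℕ c)) (trans (sym (flipped-row (toℕ c)))
        (rowSum g (toℕ c) (inRange (Fin.toℕ<n c)))))
      (content-cnt F (λ {i} i<H → trans (sym (flipped-column i)) (columnSum g i<H)))
      (avoids231-121⁻ Λ F λ {i} {j} {k} {x} {y} {z} j≤k k<i x≤y y<z z< xi yj zk →
        clash (bad-complete X i j≤k k<i (trans (X≡ j y) yj) (trans (X≡ k z) zk))
              (avoiding g i (inRange (one-column Λ F xi)) x≤y y<z (conjugate-⁺ ns (decreasing Λ) z<) (trans (X≡ i x) xi)))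
      where
      inRange : ∀ {c} → c < W → c < length hs
      inRange {c} = subst (c <_) (sym (length-conjugate ns (decreasing Λ)))

  rows-linked : Linked _≥_ (W ∷ ns)
  rows-linked = top ns (decreasing Λ)
    where
    top : ∀ ns → Linked _≥_ ns → Linked _≥_ (ns ‼ 0 ∷ ns)
    top []      _   = [-]
    top (_ ∷ _) dec = ≤-refl ∷ dec

  count-upright : ∣W∣ Λ a (w312 ∷ w211 ∷ []) ≡ process (const 1) W ns (a ‼_) ε
  count-upright = Transfer.count-process ns ns false there-bits back-one (const 1) W (a ‼_) rows-linked
    (inW? Λ a (w312 ∷ w211 ∷ []))
    (λ F → InW⇒upright F (one F) (λ _ _ → refl)) upright⇒InW
    where
    there-bits : ∀ (F : Filling ns) i c → bits (fillRight (one F) ns) i c ≡ one F i c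
    there-bits F i c with c <? ns ‼ i
    ... | yes c< = bits-fillRight (one F) ns c<
    ... | no  c≮ = trans (bits-outside (fillRight (one F) ns) (≮⇒≥ c≮)) (sym (one-outside F (≮⇒≥ c≮)))
    back-one : ∀ (G : Filling ns) i c → one (fill (bits G) ns) i c ≡ bits G i c
    back-one G i c with c <? ns ‼ i
    ... | yes c< = cong isOne (entry-fill (bits G) ns c<)
    ... | no  c≮ = trans (one-outside (fill (bits G) ns) (≮⇒≥ c≮)) (sym (bits-outside G (≮⇒≥ c≮)))

  count-flipped : ∣W∣ Λ a (w231 ∷ w121 ∷ []) ≡ process (a ‼_) H hs (const 1) ε
  count-flipped = Transfer.count-process ns hs true there-bits back-one (a ‼_) H (const 1)
    (conjugate-linked ns (decreasing Λ)) (inW? Λ a (w231 ∷ w121 ∷ []))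
    (λ F → InW⇒flipped F (flip (one F)) (λ _ _ → refl)) flipped⇒InW
    where
    there-bits : ∀ (F : Filling ns) i c → bits (fillRight (flip (one F)) hs) i c ≡ one F c i
    there-bits F i c with c <? hs ‼ i
    ... | yes c< = bits-fillRight (flip (one F)) hs c<
    ... | no  c≮ = trans (bits-outside (fillRight (flip (one F)) hs) (≮⇒≥ c≮)) (sym (column-beyond F i (≮⇒≥ c≮)))
    back-one : ∀ (G : Filling hs) i c → one (fill (flip (bits G)) ns) i c ≡ bits G c i
    back-one G i c with c <? ns ‼ i
    ... | yes c< = cong isOne (entry-fill (flip (bits G)) ns c<)
    ... | no  c≮ = trans (one-outside (fill (flip (bits G)) ns) (≮⇒≥ c≮))
      (sym (bits-outside G (≮⇒≥ (c≮ ∘ conjugate-⁻ ns (decreasing Λ)))))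

‼-positive : ∀ {a} → All (1 ≤_) a → ∀ {i} → i < length a → 1 ≤ a ‼ i
‼-positive (1≤ ∷ _)   {zero}  _        = 1≤
‼-positive (_ ∷ rest) {suc i} (s≤s i<) = ‼-positive rest i<

-- Positivity of `a` enters here: the first missing row above the shape would have to contain a 1.
∣W∣-long : ∀ Λ a Ω → All (1 ≤_) a → height Λ < length a → ∣W∣ Λ a Ω ≡ 0
∣W∣-long Λ a Ω pos long = cong length (filter-none (inW? Λ a Ω) (All.universal impossible (fillings (rows Λ))))
  where
  impossible : ∀ F → ¬ InW Λ a Ω F
  impossible F w = contradiction
    (trans (sym (onesInRow-beyond Λ F ≤-refl)) (InW.content w (height Λ)))
    (<⇒≢ (‼-positive pos long))

theorem15 : ShapeWilfEquivalent (w231 ∷ w121 ∷ []) (w312 ∷ w211 ∷ [])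
theorem15 Λ a pos = either (length a ≤? height Λ)
  where
  open ≡-Reasoning
  either : Dec (length a ≤ height Λ) → ∣W∣ Λ a (w231 ∷ w121 ∷ []) ≡ ∣W∣ Λ a (w312 ∷ w211 ∷ [])
  either (yes short) = begin
    ∣W∣ Λ a (w231 ∷ w121 ∷ [])                                 ≡⟨ count-flipped Λ a short ⟩
    process (a ‼_) (height Λ) (conjugate (rows Λ)) (const 1) ε ≡⟨ process-conjugate (a ‼_) (rows Λ) (decreasing Λ) ⟩
    process (const 1) (width Λ) (rows Λ) (a ‼_) ε              ≡⟨ count-upright Λ a short ⟨
    ∣W∣ Λ a (w312 ∷ w211 ∷ [])                                 ∎
  either (no long) = trans (∣W∣-long Λ a (w231 ∷ w121 ∷ []) pos (≰⇒> long))
    (sym (∣W∣-long Λ a (w312 ∷ w211 ∷ []) pos (≰⇒> long)))
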